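{- Let $\mathcal{CS}$ be a variant closed and axiomatically appropriate constant specification. The canonical model $\mathcal M=\langle\mathcal W,\mathcal R,\mathcal D,\mathcal I,\mathcal E\rangle$ of FOLPb using $\mathcal{CS}$ is fully explanatory: for every $\Gamma\in\mathcal W$ and every closed Henkin formula $\varphi$ (no free basic variables, possibly containing witness variables), if $\mathcal M,\Delta\Vdash\varphi$ for every $\Delta\in\mathcal W$ with $\Gamma\mathcal R\Delta$, then there is a justification term $t$ with $\mathcal M,\Gamma\Vdash t{:}_X\varphi$, where $X$ is the set of witness variables occurring in $\varphi$.
   Context: Syntax of FOLPb: terms $t::=p_i\mid c\mid t\cdot t\mid t+t\mid !t\mid\mathsf b(t)\mid\mathsf{gen}_x(t)$; formulas $Px_1\dots x_n\mid\bot\mid\varphi\to\varphi\mid\forall x\varphi\mid t{:}_X\varphi$ ($X$ finite set of individual variables, $fv(t{:}_X\psi)=X$). Axioms: A1 classical first-order; A2 $t{:}_{Xy}\varphi\to t{:}_X\varphi$ ($y$ not free in $\varphi$); A3 $t{:}_X\varphi\to t{:}_{Xy}\varphi$; B1 $t{:}_X\varphi\to\varphi$; B2 $t{:}_X(\varphi\to\psi)\to(s{:}_X\varphi\to[t\cdot s]{:}_X\psi)$; B3 $t{:}_X\varphi\to[t+s]{:}_X\varphi$, $s{:}_X\varphi\to[t+s]{:}_X\varphi$; B4 $t{:}_X\varphi\to!t{:}_Xt{:}_X\varphi$; B5 $t{:}_X\varphi\to\mathsf{gen}_x(t){:}_X\forall x\varphi$ ($x\notin X$); Bb $\forall y\,t{:}_{Xy}\varphi(y)\to\mathsf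 b(t){:}_X\forall y\varphi(y)$; rules MP and generalization. Constant specification: set of $c{:}\psi$ with $\psi$ an axiom; axiomatically appropriate: every axiom gets some constant; variant closed: closed under one-to-one onto renamings of free individual variables. Henkin language: $\mathbf V$ countable set of new witness variables, occurring free only (never quantified, never $\mathsf{gen}$ subscripts); Henkin formulas $\mathit{Fml}_J(\mathbf V)$; closed = no free basic variables. $\mathcal{CS}(\mathbf V)$: all $c{:}\psi$ with $c{:}\varphi\in\mathcal{CS}$ and $\psi$ obtained from $\varphi$ by replacing some free basic variables with distinct witness variables; $\vdash_{\mathcal{CS}(\mathbf V)}$, consistency and maximal consistency are relative to the axiom system over $\mathit{Fml}_J(\mathbf V)$ with $\mathcal{CS}(\mathbf V)$. $\Gamma^\#=\{\forall\vec y\varphi: t{:}_X\varphi\in\Gamma$ closed, $X$ = witness variables of $\varphi$, $\vec y$ = free basic variables of $\varphi\}$. A set $\Gamma$ admits instantiation if for every disjunctive template $F(\vec{\mathbf p},\mathbf q)$ (a propositional modal formula built with $\vee$ and $\Box$ only, each letter at most once), every sequence $\vec\varphi$ of Henkin formulas and every $\forall x\varphi(x)$: if $\Gamma\cup[\![\neg F(\vec\varphi,\forall x\varphi(x))]\!]$ is consistent then $\Gamma\cup[\![\neg F(\vec\varphi,\varphi(a))]\!]$ is consistent for some $a\in\mathbf V$; here the instantiation set $[\![F(\vec\varphi)]\!]$ is defined by $[\![\mathbf p_i]\!]=\{\varphi_i\}$, $[\![\neg G]\!]=\{\neg\psi:\psi\in[\![G]\!]\}$, $[\![G\vee H]\!]=\{\psi\vee\theta:\psi\in[\![G]\!],\theta\in[\![H]\!]\}$,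 similarly for $\wedge$, and $[\![\Box G]\!]=\{t{:}_X\psi:\psi\in[\![G]\!]$, $t$ any term, $X$ the witness variables of $\psi\}$. Canonical model: $\mathcal W$ = all $\mathcal{CS}(\mathbf V)$-maximally consistent sets admitting instantiation; $\Gamma\mathcal R\Delta$ iff $\Gamma^\#\subseteq\Delta$; $\mathcal D=\mathbf V$; $\mathcal I(P,\Gamma)=\{\vec a: P(\vec a)\in\Gamma\}$; $\Gamma\in\mathcal E(t,\varphi)$ iff $t{:}_X\varphi\in\Gamma$ with $X$ the witness variables in $\varphi$. Truth in it: atomic via $\mathcal I$; $\forall x\psi$ iff $\psi(a)$ for all $a\in\mathbf V$; $\Gamma\Vdash t{:}_X\psi(\vec x)$ ($\vec x$ the free basic variables of $\psi$) iff $\Gamma\in\mathcal E(t,\psi(\vec x))$ and $\Delta\Vdash\psi(\vec a)$ for all $\Delta$ with $\Gamma\mathcal R\Delta$ and all $\vec a\in\mathbf V$. -}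

module Defs where

open import Data.Nat using (ℕ; zero; suc; _*_; _<_; _≤_; _⊔_; s≤s)
open import Data.Nat.Properties using (<-cmp; ≤-refl; m⊔n≤o⇒m≤o; m⊔n≤o⇒n≤o; m≤m⊔n; m≤n⊔m)
import Data.Nat.Properties as ℕₚ
open import Data.Fin using (Fin)
open import Data.Vec as Vec using (Vec; lookup; toList)
open import Data.Vec.Relation.Unary.All as VecAll using ()
open import Data.List using (List; []; _∷_; _++_; map; foldr; filter; mapMaybe)
open import Data.List.Relation.Unary.All using (All)
open import Data.List.Relation.Unary.Linked using (Linked; []; [-]; _∷_)
open import Data.List.Relation.Unary.Unique.Propositional using (Unique)
open import Data.List.Membership.Propositional as ListMem using ()
import Data.List.Membership.DecPropositional as DecMem
open import Data.Maybe using (Maybe; just; nothing; maybe′)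
open import Data.Product using (∃; ∃₂; _×_; _,_)
open import Data.Sum using (_⊎_)
open import Data.Empty using (⊥)
open import Data.Unit using (⊤)
open import Function using (_⇔_; mk⇔)
open import Level using (Lift; 0ℓ)
open import Relation.Binary using (DecidableEquality; tri<; tri≈; tri>)
open import Relation.Binary.PropositionalEquality using (_≡_; _≢_; refl; cong; cong₂; subst; sym)
open import Relation.Nullary using (Dec; no; ¬_; does)
open import Relation.Nullary.Decidable using (map′; ¬?)
open import Relation.Unary using (Pred; _∈_; _⊆_; _∪_; ｛_｝)
open import Data.Bool using (if_then_else_)

-- The members of 𝐕 are the variables  wit a ; quantifiers and gen only take
-- basic variables, given by their index.
data Var : Set where
  basic : ℕ → Var
  wit   : ℕ → Var

_≟_ : DecidableEquality Var
basic x ≟ basic y = map′ (cong basic) (λ { refl → refl }) (x ℕₚ.≟ y)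
basic x ≟ wit b   = no λ ()
wit a   ≟ basic y = no λ ()
wit a   ≟ wit b   = map′ (cong wit) (λ { refl → refl }) (a ℕₚ.≟ b)

key : Var → ℕ
key (basic x) = x * 2
key (wit a)   = suc (a * 2)

_≺_ : Var → Var → Set
v ≺ w = key v < key w

-- Strictly increasing lists, so that sets with the same members are
-- propositionally equal and t ∶[ X ] φ depends on X as a set only.
record VarSet : Set where
  constructor mkSet
  field
    elems   : List Var
    .sorted : Linked _≺_ elems

open VarSet public

insertList : Var → List Var → List Var
insertList v []       = v ∷ []
insertList v (w ∷ ws) with <-cmp (key v) (key w)
... | tri< _ _ _ = v ∷ w ∷ ws
... | tri≈ _ _ _ = w ∷ ws
... | tri> _ _ _ = w ∷ insertList v ws

private
  insert-below : ∀ {u v} ws → u ≺ v → Linked _≺_ (u ∷ ws) → Linked _≺_ (insertList v ws) →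
                 Linked _≺_ (u ∷ insertList v ws)
  insert-below []       u≺v _ l = u≺v ∷ l
  insert-below {v = v} (w ∷ ws) u≺v (u≺w ∷ _) l with <-cmp (key v) (key w)
  ... | tri< _ _ _ = u≺v ∷ l
  ... | tri≈ _ _ _ = u≺w ∷ l
  ... | tri> _ _ _ = u≺w ∷ l

  tail-sorted : ∀ {w ws} → Linked _≺_ (w ∷ ws) → Linked _≺_ ws
  tail-sorted [-]     = []
  tail-sorted (_ ∷ l) = l

insert-sorted : ∀ v ws → Linked _≺_ ws → Linked _≺_ (insertList v ws)
insert-sorted v []       _ = [-]
insert-sorted v (w ∷ ws) l with <-cmp (key v) (key w)
... | tri< v≺w _ _ = v≺w ∷ l
... | tri≈ _ _ _   = l
... | tri> _ _ w≺v = insert-below ws w≺v l (insert-sorted v ws (tail-sorted l))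

∅ : VarSet
∅ = mkSet [] []

insert : Var → VarSet → VarSet
insert v (mkSet ws l) = mkSet (insertList v ws) (insert-sorted v ws l)

fromList : List Var → VarSet
fromList = foldr insert ∅

_∈ₛ_ : Var → VarSet → Set
v ∈ₛ X = v ListMem.∈ elems X

_∈ₛ?_ : ∀ v X → Dec (v ∈ₛ X)
v ∈ₛ? X = DecMem._∈?_ _≟_ v (elems X)

mapSet : (Var → Var) → VarSet → VarSet
mapSet σ X = fromList (map σ (elems X))

_∪ₛ_ : VarSet → VarSet → VarSet
X ∪ₛ Y = fromList (elems X ++ elems Y)

_-ₛ_ : VarSet → Var → VarSet
X -ₛ v = fromList (filter (λ w → ¬? (w ≟ v)) (elems X))

infixl 8 _·_
infixl 7 _⊹_

data Term : Set where
  jvar  : ℕ → Term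
  const : ℕ → Term
  _·_   : Term → Term → Term
  _⊹_   : Term → Term → Term
  !_    : Term → Term
  b     : Term → Term
  gen   : ℕ → Term → Term

infixr 4 _⇒_
infixr 6 _∶[_]_

-- atom {n} P vs : the P-th predicate symbol of arity n.
data Fml : Set where
  atom   : ∀ {n} → ℕ → Vec Var n → Fml
  ⊥'     : Fml
  _⇒_    : Fml → Fml → Fml
  ∀'     : ℕ → Fml → Fml
  _∶[_]_ : Term → VarSet → Fml → Fml

∼_ : Fml → Fml
∼ φ = φ ⇒ ⊥'

_∨'_ _∧'_ : Fml → Fml → Fml
φ ∨' ψ = ∼ φ ⇒ ψ
φ ∧' ψ = ∼ (φ ⇒ ∼ ψ)

fv : Fml → VarSet
fv (atom P vs)    = fromList (toList vs)
fv ⊥'             = ∅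
fv (φ ⇒ ψ)        = fv φ ∪ₛ fv ψ
fv (∀' x φ)       = fv φ -ₛ basic x
fv (t ∶[ X ] φ)   = X

basicIndex witIndex : Var → Maybe ℕ
basicIndex (basic x) = just x
basicIndex (wit a)   = nothing
witIndex (basic x) = nothing
witIndex (wit a)   = just a

freeBasics : Fml → List ℕ
freeBasics φ = mapMaybe basicIndex (elems (fv φ))

-- In a Henkin formula all witness variables are free, so this is the set of
-- all witness variables occurring in it.
wits : Fml → VarSet
wits φ = fromList (map wit (mapMaybe witIndex (elems (fv φ))))

data GenSubscript (x : ℕ) : Term → Set where
  here : ∀ {t} → GenSubscript x (gen x t)
  gen  : ∀ {y t} → GenSubscript x t → GenSubscript x (gen y t)
  ·ˡ   : ∀ {t s} → GenSubscript x t → GenSubscript x (t · s)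
  ·ʳ   : ∀ {t s} → GenSubscript x s → GenSubscript x (t · s)
  ⊹ˡ   : ∀ {t s} → GenSubscript x t → GenSubscript x (t ⊹ s)
  ⊹ʳ   : ∀ {t s} → GenSubscript x s → GenSubscript x (t ⊹ s)
  !_   : ∀ {t} → GenSubscript x t → GenSubscript x (! t)
  b    : ∀ {t} → GenSubscript x t → GenSubscript x (b t)

-- No occurrence of v is quantified, a gen subscript, or inside some t ∶[ X ] ψ
-- with v not in X (there v would be bound, since fv (t ∶[ X ] ψ) = X).
OnlyFree : Var → Fml → Set
OnlyFree v (atom P vs)  = ⊤
OnlyFree v ⊥'           = ⊤
OnlyFree v (φ ⇒ ψ)      = OnlyFree v φ × OnlyFree v ψ
OnlyFree v (∀' x φ)     = v ≢ basic x × OnlyFree v φ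
OnlyFree v (t ∶[ X ] φ) =
  (∀ x → v ≡ basic x → ¬ GenSubscript x t) × OnlyFree v φ × (v ∈ₛ fv φ → v ∈ₛ X)

Henkin : Fml → Set
Henkin φ = ∀ a → OnlyFree (wit a) φ

Closed : Fml → Set
Closed φ = ∀ x → ¬ (basic x ∈ₛ fv φ)

data IsBasicVar : Var → Set where
  basic : ∀ x → IsBasicVar (basic x)

-- Formulas of the language without witness variables.
BasicFml : Fml → Set
BasicFml (atom P vs)  = VecAll.All IsBasicVar vs
BasicFml ⊥'           = ⊤
BasicFml (φ ⇒ ψ)      = BasicFml φ × BasicFml ψ
BasicFml (∀' x φ)     = BasicFml φ
BasicFml (t ∶[ X ] φ) = All IsBasicVar (elems X) × BasicFml φ

except : ℕ → (Var → Var) → Var → Var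
except x σ v = if does (v ≟ basic x) then v else σ v

restrict : VarSet → (Var → Var) → Var → Var
restrict X σ v = if does (v ∈ₛ? X) then σ v else v

-- Simultaneous replacement of free occurrences; it does not rename bound
-- variables.
sub : (Var → Var) → Fml → Fml
sub σ (atom P vs)  = atom P (Vec.map σ vs)
sub σ ⊥'           = ⊥'
sub σ (φ ⇒ ψ)      = sub σ φ ⇒ sub σ ψ
sub σ (∀' x φ)     = ∀' x (sub (except x σ) φ)
sub σ (t ∶[ X ] φ) = t ∶[ mapSet σ X ] sub (restrict X σ) φ

single : ℕ → Var → Var → Var
single x v w = if does (w ≟ basic x) then v else w

_[_≔_] : Fml → ℕ → Var → Fml
φ [ x ≔ v ] = sub (single x v) φ

-- v is free for x in φ.
FreeFor : Var → ℕ → Fml → Set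
FreeFor v x (atom P vs)  = ⊤
FreeFor v x ⊥'           = ⊤
FreeFor v x (φ ⇒ ψ)      = FreeFor v x φ × FreeFor v x ψ
FreeFor v x (∀' z φ)     = ¬ (basic x ∈ₛ fv (∀' z φ)) ⊎ (v ≢ basic z × FreeFor v x φ)
FreeFor v x (t ∶[ X ] φ) = ¬ (basic x ∈ₛ X) ⊎ (FreeFor v x φ × (v ∈ₛ fv φ → v ∈ₛ X))

∀* : List ℕ → Fml → Fml
∀* xs φ = foldr ∀' φ xs

data Axiom : Fml → Set where
  A1-K  : ∀ {φ ψ} → Axiom (φ ⇒ ψ ⇒ φ)
  A1-S  : ∀ {φ ψ χ} → Axiom ((φ ⇒ ψ ⇒ χ) ⇒ (φ ⇒ ψ) ⇒ φ ⇒ χ)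
  A1-DN : ∀ {φ} → Axiom (∼ ∼ φ ⇒ φ)
  A1-∀E : ∀ {x v φ} → FreeFor v x φ → Axiom (∀' x φ ⇒ φ [ x ≔ v ])
  A1-∀D : ∀ {x φ ψ} → ¬ (basic x ∈ₛ fv φ) → Axiom (∀' x (φ ⇒ ψ) ⇒ φ ⇒ ∀' x ψ)
  A2    : ∀ {t X y φ} → ¬ (y ∈ₛ fv φ) → Axiom (t ∶[ insert y X ] φ ⇒ t ∶[ X ] φ)
  A3    : ∀ {t X y φ} → Axiom (t ∶[ X ] φ ⇒ t ∶[ insert y X ] φ)
  B1    : ∀ {t X φ} → Axiom (t ∶[ X ] φ ⇒ φ)
  B2    : ∀ {t s X φ ψ} → Axiom (t ∶[ X ] (φ ⇒ ψ) ⇒ s ∶[ X ] φ ⇒ (t · s) ∶[ X ] ψ)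
  B3ˡ   : ∀ {t s X φ} → Axiom (t ∶[ X ] φ ⇒ (t ⊹ s) ∶[ X ] φ)
  B3ʳ   : ∀ {t s X φ} → Axiom (s ∶[ X ] φ ⇒ (t ⊹ s) ∶[ X ] φ)
  B4    : ∀ {t X φ} → Axiom (t ∶[ X ] φ ⇒ (! t) ∶[ X ] t ∶[ X ] φ)
  B5    : ∀ {t X x φ} → ¬ (basic x ∈ₛ X) → Axiom (t ∶[ X ] φ ⇒ gen x t ∶[ X ] ∀' x φ)
  Bb    : ∀ {t X y φ} → Axiom (∀' y (t ∶[ insert (basic y) X ] φ) ⇒ b t ∶[ X ] ∀' y φ)

-- spec c φ : the formula c:φ, that is c ∶[ ∅ ] φ, belongs to the specification.
record ConstSpec : Set₁ where
  field
    spec    : ℕ → Pred Fml 0ℓ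
    isAxiom : ∀ {c φ} → spec c φ → Axiom φ
    isBasic : ∀ {c φ} → spec c φ → BasicFml φ

open ConstSpec public

AxiomaticallyAppropriate : ConstSpec → Set
AxiomaticallyAppropriate CS = ∀ {φ} → BasicFml φ → Axiom φ → ∃ λ c → spec CS c φ

rename : (ℕ → ℕ) → Var → Var
rename ρ (basic x) = basic (ρ x)
rename ρ (wit a)   = wit a

-- ρ restricts to a bijection from the free variables of φ to those of ψ.  A
-- variable and the different one that replaces it have no bound occurrence in
-- φ: otherwise the axiom t:Py → t:_{y}Py would have the variant
-- t:Py → t:_{z}Pz, which is not an axiom, and no axiomatically appropriate
-- specification would be variant closed.
record Variant (φ ψ : Fml) : Set where
  field
    ρ         : ℕ → ℕ
    injective : ∀ {x y} → basic x ∈ₛ fv φ → basic y ∈ₛ fv φ → ρ x ≡ ρ y → x ≡ y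
    noClash   : ∀ {x} → basic x ∈ₛ fv φ → ρ x ≢ x →
                OnlyFree (basic x) φ × OnlyFree (basic (ρ x)) φ
    result    : ψ ≡ sub (rename ρ) φ

VariantClosed : ConstSpec → Set
VariantClosed CS = ∀ {c φ ψ} → Variant φ ψ → spec CS c φ → spec CS c ψ

replace : (ℕ → Maybe ℕ) → Var → Var
replace σ (basic x) = maybe′ wit (basic x) (σ x)
replace σ (wit a)   = wit a

-- CS(𝐕).  The witness variables of ψ have to be free in c:ψ, hence the
-- subscript  wits ψ ; it is ∅ if nothing is replaced.
data HenkinSpec (CS : ConstSpec) : Pred Fml 0ℓ where
  witnessed : ∀ {c φ} (σ : ℕ → Maybe ℕ) → spec CS c φ →
           (∀ {x y a} → basic x ∈ₛ fv φ → basic y ∈ₛ fv φ →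
             σ x ≡ just a → σ y ≡ just a → x ≡ y) →
           let ψ = sub (replace σ) φ in HenkinSpec CS (const c ∶[ wits ψ ] ψ)

infix 2 _⊢_

data _⊢_ (CS : ConstSpec) : Pred Fml 0ℓ where
  ax  : ∀ {φ} → Henkin φ → Axiom φ → CS ⊢ φ
  cs  : ∀ {φ} → HenkinSpec CS φ → CS ⊢ φ
  mp  : ∀ {φ ψ} → CS ⊢ φ ⇒ ψ → CS ⊢ φ → CS ⊢ ψ
  gen : ∀ {φ} x → CS ⊢ φ → CS ⊢ ∀' x φ

⋀ : List Fml → Fml
⋀ = foldr _∧'_ (∼ ⊥')

Consistent : ConstSpec → Pred Fml 0ℓ → Set
Consistent CS Γ = ∀ γs → All Γ γs → ¬ (CS ⊢ ⋀ γs ⇒ ⊥')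

record MaximallyConsistent (CS : ConstSpec) (Γ : Pred Fml 0ℓ) : Set where
  field
    henkin     : Γ ⊆ Henkin
    consistent : Consistent CS Γ
    maximal    : ∀ {φ} → Henkin φ → Consistent CS (Γ ∪ ｛ φ ｝) → φ ∈ Γ

data Modal (n : ℕ) : Set where
  letter    : Fin n → Modal n
  neg       : Modal n → Modal n
  conj disj : Modal n → Modal n → Modal n
  □         : Modal n → Modal n

letters : ∀ {n} → Modal n → List (Fin n)
letters (letter i) = i ∷ []
letters (neg F)    = letters F
letters (conj F G) = letters F ++ letters G
letters (disj F G) = letters F ++ letters G
letters (□ F)      = letters F

data Disjunctive {n} : Modal n → Set where
  letter : ∀ i → Disjunctive (letter i)
  disj   : ∀ {F G} → Disjunctive F → Disjunctive G → Disjunctive (disj F G)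
  □      : ∀ {F} → Disjunctive F → Disjunctive (□ F)

record DisjunctiveTemplate {n} (F : Modal n) : Set where
  field
    disjunctive : Disjunctive F
    atMostOnce  : Unique (letters F)

⟦_⟧ : ∀ {n} → Modal n → Vec Fml n → Pred Fml 0ℓ
⟦ letter i ⟧ φs χ = χ ≡ lookup φs i
⟦ neg F ⟧    φs χ = ∃ λ ψ → ψ ∈ ⟦ F ⟧ φs × χ ≡ ∼ ψ
⟦ conj F G ⟧ φs χ = ∃₂ λ ψ θ → ψ ∈ ⟦ F ⟧ φs × θ ∈ ⟦ G ⟧ φs × χ ≡ (ψ ∧' θ)
⟦ disj F G ⟧ φs χ = ∃₂ λ ψ θ → ψ ∈ ⟦ F ⟧ φs × θ ∈ ⟦ G ⟧ φs × χ ≡ (ψ ∨' θ)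
⟦ □ F ⟧      φs χ = ∃₂ λ t ψ → ψ ∈ ⟦ F ⟧ φs × χ ≡ (t ∶[ wits ψ ] ψ)

-- In F (𝐩₁ … 𝐩ₙ , 𝐪) the letter 𝐪 has index zero.
AdmitsInstantiation : ConstSpec → Pred Fml 0ℓ → Set
AdmitsInstantiation CS Γ =
  ∀ {n} (F : Modal (suc n)) → DisjunctiveTemplate F →
  (φs : Vec Fml n) → VecAll.All Henkin φs →
  ∀ x φ → Henkin (∀' x φ) →
  Consistent CS (Γ ∪ ⟦ neg F ⟧ (∀' x φ Vec.∷ φs)) →
  ∃ λ a → Consistent CS (Γ ∪ ⟦ neg F ⟧ (φ [ x ≔ wit a ] Vec.∷ φs))

_♯ : Pred Fml 0ℓ → Pred Fml 0ℓ
(Γ ♯) χ = ∃₂ λ t φ → (t ∶[ wits φ ] φ) ∈ Γ × χ ≡ ∀* (freeBasics φ) φ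

record 𝓦 (CS : ConstSpec) : Set₁ where
  field
    set   : Pred Fml 0ℓ
    mcs   : MaximallyConsistent CS set
    admit : AdmitsInstantiation CS set

open 𝓦 public

ground : (ℕ → ℕ) → Var → Var
ground v (basic x) = wit (v x)
ground v (wit a)   = wit a

depth : Fml → ℕ
depth (atom P vs)  = 0
depth ⊥'           = 0
depth (φ ⇒ ψ)      = suc (depth φ ⊔ depth ψ)
depth (∀' x φ)     = suc (depth φ)
depth (t ∶[ X ] φ) = suc (depth φ)

module _ {CS : ConstSpec} where

  𝓡 : 𝓦 CS → 𝓦 CS → Set
  𝓡 Γ Δ = (set Γ ♯) ⊆ set Δ

  -- The domain 𝓓 = 𝐕 is represented by the indices a of the wit a.
  𝓘 : ∀ {n} → ℕ → 𝓦 CS → Pred (Vec ℕ n) 0ℓ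
  𝓘 P Γ as = atom P (Vec.map wit as) ∈ set Γ

  𝓔 : Term → Fml → Pred (𝓦 CS) 0ℓ
  𝓔 t φ Γ = (t ∶[ wits φ ] φ) ∈ set Γ

  -- The recursion is on a bound for the depth, since ψ [ x ≔ wit a ] is not a
  -- subformula of ∀' x ψ.  See ⊩-⇒, ⊩-∀ and ⊩-∶ for the resulting clauses.
  Forces : ℕ → 𝓦 CS → Fml → Set₁
  Forces k       Γ (atom P vs)  = Lift _ (∃ λ as → vs ≡ Vec.map wit as × as ∈ 𝓘 P Γ)
  Forces k       Γ ⊥'           = Lift _ ⊥
  Forces zero    Γ _            = Lift _ ⊥
  Forces (suc k) Γ (φ ⇒ ψ)      = Forces k Γ φ → Forces k Γ ψ
  Forces (suc k) Γ (∀' x ψ)     = ∀ a → Forces k Γ (ψ [ x ≔ wit a ])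
  Forces (suc k) Γ (t ∶[ X ] ψ) =
    Γ ∈ 𝓔 t ψ × (∀ Δ → 𝓡 Γ Δ → ∀ v → Forces k Δ (sub (ground v) ψ))

  infix 2 _⊩_

  _⊩_ : 𝓦 CS → Fml → Set₁
  Γ ⊩ φ = Forces (depth φ) Γ φ

depth-sub : ∀ σ φ → depth (sub σ φ) ≡ depth φ
depth-sub σ (atom P vs)  = refl
depth-sub σ ⊥'           = refl
depth-sub σ (φ ⇒ ψ)      = cong₂ (λ m n → suc (m ⊔ n)) (depth-sub σ φ) (depth-sub σ ψ)
depth-sub σ (∀' x φ)     = cong suc (depth-sub (except x σ) φ)
depth-sub σ (t ∶[ X ] φ) = cong suc (depth-sub (restrict X σ) φ)

module _ {CS : ConstSpec} where

  Forces-bound : ∀ {j k} {Γ : 𝓦 CS} φ → depth φ ≤ j → depth φ ≤ k → Forces j Γ φ → Forces k Γ φ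
  Forces-bound (atom P vs) _ _ h = h
  Forces-bound ⊥' _ _ h = h
  Forces-bound (φ ⇒ ψ) (s≤s p) (s≤s q) h f =
    Forces-bound ψ (m⊔n≤o⇒n≤o (depth φ) _ p) (m⊔n≤o⇒n≤o (depth φ) _ q)
      (h (Forces-bound φ (m⊔n≤o⇒m≤o _ (depth ψ) q) (m⊔n≤o⇒m≤o _ (depth ψ) p) f))
  Forces-bound {j} {k} (∀' x φ) (s≤s p) (s≤s q) h a =
    Forces-bound (φ [ x ≔ wit a ])
      (subst (_≤ _) (sym (depth-sub (single x (wit a)) φ)) p)
      (subst (_≤ _) (sym (depth-sub (single x (wit a)) φ)) q) (h a)
  Forces-bound (t ∶[ X ] φ) (s≤s p) (s≤s q) (e , h) = e , λ Δ r v →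
    Forces-bound (sub (ground v) φ)
      (subst (_≤ _) (sym (depth-sub (ground v) φ)) p)
      (subst (_≤ _) (sym (depth-sub (ground v) φ)) q) (h Δ r v)

  ⊩-⇒ : ∀ {Γ : 𝓦 CS} φ ψ → (Γ ⊩ φ ⇒ ψ) ⇔ (Γ ⊩ φ → Γ ⊩ ψ)
  ⊩-⇒ φ ψ = mk⇔
    (λ h f → Forces-bound ψ (m≤n⊔m (depth φ) _) ≤-refl (h (Forces-bound φ ≤-refl (m≤m⊔n _ _) f)))
    (λ h f → Forces-bound ψ ≤-refl (m≤n⊔m (depth φ) _) (h (Forces-bound φ (m≤m⊔n _ _) ≤-refl f)))

  ⊩-∀ : ∀ {Γ : 𝓦 CS} x ψ → (Γ ⊩ ∀' x ψ) ⇔ (∀ a → Γ ⊩ ψ [ x ≔ wit a ])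
  ⊩-∀ {Γ} x ψ = mk⇔
    (λ h a → subst (λ k → Forces k Γ (ψ [ x ≔ wit a ])) (sym (depth-sub (single x (wit a)) ψ)) (h a))
    (λ h a → subst (λ k → Forces k Γ (ψ [ x ≔ wit a ])) (depth-sub (single x (wit a)) ψ) (h a))

  ⊩-∶ : ∀ {Γ : 𝓦 CS} t X ψ →
        (Γ ⊩ t ∶[ X ] ψ) ⇔ (Γ ∈ 𝓔 t ψ × (∀ Δ → 𝓡 Γ Δ → ∀ v → Δ ⊩ sub (ground v) ψ))
  ⊩-∶ t X ψ = mk⇔
    (λ (e , h) → e , λ Δ r v →
      subst (λ k → Forces k Δ (sub (ground v) ψ)) (sym (depth-sub (ground v) ψ)) (h Δ r v))
    (λ (e , h) → e , λ Δ r v →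
      subst (λ k → Forces k Δ (sub (ground v) ψ)) (depth-sub (ground v) ψ) (h Δ r v))

{-# OPTIONS --safe #-}

-- If no t ∶[ wits φ ] φ is in Γ, then Γ ♯ ∪ {∼ φ} is consistent: a derivation of
-- φ from Γ ♯ internalizes to a term, because every Henkin axiom is an instance,
-- with distinct witness variables, of an axiom without witness variables, and
-- that one has a constant.  Γ ♯ ∪ {∼ φ} is then extended to a world Δ.  At each
-- stage the added formulas are ⟦ neg G ⟧ for one disjunctive template G.  Terms
-- of the form s ⊹ t make ⟦ G ⟧ directed, so inconsistency of Γ ♯ ∪ ⟦ neg G ⟧
-- means that Γ contains some member of ⟦ □ G ⟧, and the instantiation property
-- of Γ for □ (G ∨ F) yields a witness for F at this stage.  By the truth lemma
-- φ fails at Δ, although Γ 𝓡 Δ.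
module Submission where

open import Defs
open import Axiom.ExcludedMiddle using (ExcludedMiddle)
open import Data.Bool using (if_then_else_)
open import Data.Fin using (Fin; zero; suc; _↑ˡ_; _↑ʳ_; splitAt)
import Data.Fin.Properties as Finₚ
open import Data.List using (List; []; _∷_; _++_; map; mapMaybe; foldr; foldl)
open import Data.List.Membership.Propositional using () renaming (_∈_ to _∈ₗ_)
open import Data.List.Membership.Propositional.Properties using (∈-map⁺; ∈-map⁻; ∈-++⁺ˡ; ∈-++⁺ʳ; ∈-++⁻; ∈-filter⁺; ∈-filter⁻)
open import Data.List.Properties using (map-++)
open import Data.List.Relation.Unary.All as All using (All; []; _∷_)
import Data.List.Relation.Unary.All.Properties as Allₚ
open import Data.List.Relation.Unary.AllPairs using (AllPairs; []; _∷_)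
open import Data.List.Relation.Unary.Any using (here; there)
open import Data.List.Relation.Unary.Linked using (linked?)
open import Data.List.Relation.Unary.Linked.Properties using (Linked⇒AllPairs)
open import Data.List.Relation.Unary.Unique.Propositional using (Unique)
import Data.List.Relation.Unary.Unique.Propositional.Properties as Uniqueₚ
open import Data.Maybe using (Maybe; just; nothing)
open import Data.Nat using (ℕ; zero; suc; _+_; _<_; _≤_; _⊔_; s≤s)
import Data.Nat.Properties as ℕₚ
open import Data.Product using (∃; _×_; _,_; proj₁; proj₂)
open import Data.Sum using (_⊎_; inj₁; inj₂; [_,_]′)
open import Data.Unit using (tt)
open import Data.Vec as Vec using (Vec; []; _∷_; lookup; toList)
import Data.Vec.Properties as Vecₚ
open import Data.Vec.Relation.Unary.All as VecAll using ([]; _∷_)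
import Data.Vec.Relation.Unary.All.Properties as VecAllₚ
open import Function using (_∘_; id; case_of_)
open import Level as Level using (0ℓ; lift; lower)
open import Relation.Binary using (tri<; tri≈; tri>)
open import Relation.Binary.PropositionalEquality using (_≡_; _≢_; refl; sym; trans; cong; cong₂; subst)
open import Relation.Nullary using (yes; no; ¬_; does; contradiction)
open import Relation.Nullary.Decidable using (recompute; dec-true; dec-false; ¬?; map′)
open import Relation.Unary using (Pred; _∈_; _∪_; ｛_｝) renaming (∅ to ∅ᵤ)

-- Variable sets

-- The obstacle is that no witness variable is fresh. The set 𝐕 is fixed, and since instances such
-- as `P a ⇒ P a` are justified in Γ for every `a`, each of its members already occurs in `Γ ♯`. The
-- only source of witnesses is the instantiation property of Γ itself, which treats a single
-- template with a single distinguished letter. This is why the history of the construction is kept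
-- inside one template: old and new requirements are merged as `∼ (ψ ∨' θ)`, and all earlier letters
-- become parameters. Maximality comes from the same mechanism, because deciding a formula is also
-- an instantiation problem. Internalization meets two technical difficulties. Axioms B2 and B5
-- constrain subscripts, so every subscript is normalized to the witnesses of its formula by means
-- of A2 and A3. Moreover `sub` does not rename bound variables, so the basic variables that stand
-- in for witnesses have to lie beyond all basic variables of the formula.

key-injective : ∀ {v w} → key v ≡ key w → v ≡ w
key-injective {basic x} {basic y} e = cong basic (ℕₚ.*-cancelʳ-≡ x y 2 e)
key-injective {wit a} {wit c} e = cong wit (ℕₚ.*-cancelʳ-≡ a c 2 (ℕₚ.suc-injective e))
key-injective {basic x} {wit a} e =
  contradiction (trans (ℕₚ.*-comm 2 x) (trans e (cong suc (ℕₚ.*-comm a 2)))) (ℕₚ.even≢odd x a)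
key-injective {wit a} {basic x} e =
  contradiction (trans (ℕₚ.*-comm 2 x) (trans (sym e) (cong suc (ℕₚ.*-comm a 2)))) (ℕₚ.even≢odd x a)

∈-insertList⁻ : ∀ {u} v ws → u ∈ₗ insertList v ws → u ≡ v ⊎ u ∈ₗ ws
∈-insertList⁻ v [] (here e) = inj₁ e
∈-insertList⁻ v (w ∷ ws) p with ℕₚ.<-cmp (key v) (key w)
∈-insertList⁻ v (w ∷ ws) (here e) | tri< _ _ _ = inj₁ e
∈-insertList⁻ v (w ∷ ws) (there p) | tri< _ _ _ = inj₂ p
∈-insertList⁻ v (w ∷ ws) p | tri≈ _ _ _ = inj₂ p
∈-insertList⁻ v (w ∷ ws) (here e) | tri> _ _ _ = inj₂ (here e)
∈-insertList⁻ v (w ∷ ws) (there p) | tri> _ _ _ = [ inj₁ , inj₂ ∘ there ]′ (∈-insertList⁻ v ws p)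

∈-insertList⁺ˡ : ∀ v ws → v ∈ₗ insertList v ws
∈-insertList⁺ˡ v [] = here refl
∈-insertList⁺ˡ v (w ∷ ws) with ℕₚ.<-cmp (key v) (key w)
... | tri< _ _ _ = here refl
... | tri≈ _ e _ = here (key-injective e)
... | tri> _ _ _ = there (∈-insertList⁺ˡ v ws)

∈-insertList⁺ʳ : ∀ {u} v ws → u ∈ₗ ws → u ∈ₗ insertList v ws
∈-insertList⁺ʳ v (w ∷ ws) p with ℕₚ.<-cmp (key v) (key w)
∈-insertList⁺ʳ v (w ∷ ws) p | tri< _ _ _ = there p
∈-insertList⁺ʳ v (w ∷ ws) p | tri≈ _ _ _ = p
∈-insertList⁺ʳ v (w ∷ ws) (here e) | tri> _ _ _ = here e
∈-insertList⁺ʳ v (w ∷ ws) (there p) | tri> _ _ _ = there (∈-insertList⁺ʳ v ws p)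

∈-insert⁻ : ∀ {u v} X → u ∈ₛ insert v X → u ≡ v ⊎ u ∈ₛ X
∈-insert⁻ X = ∈-insertList⁻ _ (elems X)

∈-insert⁺ˡ : ∀ {v} X → v ∈ₛ insert v X
∈-insert⁺ˡ X = ∈-insertList⁺ˡ _ (elems X)

∈-insert⁺ʳ : ∀ {u v} X → u ∈ₛ X → u ∈ₛ insert v X
∈-insert⁺ʳ X = ∈-insertList⁺ʳ _ (elems X)

∈-fromList⁻ : ∀ {u} vs → u ∈ₛ fromList vs → u ∈ₗ vs
∈-fromList⁻ (v ∷ vs) p with ∈-insert⁻ (fromList vs) p
... | inj₁ e = here e
... | inj₂ q = there (∈-fromList⁻ vs q)

∈-fromList⁺ : ∀ {u vs} → u ∈ₗ vs → u ∈ₛ fromList vs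
∈-fromList⁺ {vs = v ∷ vs} (here refl) = ∈-insert⁺ˡ (fromList vs)
∈-fromList⁺ {vs = v ∷ vs} (there p) = ∈-insert⁺ʳ (fromList vs) (∈-fromList⁺ p)

∈-mapSet⁺ : ∀ σ X {v} → v ∈ₛ X → σ v ∈ₛ mapSet σ X
∈-mapSet⁺ σ X p = ∈-fromList⁺ (∈-map⁺ σ p)

∈-mapSet⁻ : ∀ σ X {v} → v ∈ₛ mapSet σ X → ∃ λ w → w ∈ₛ X × v ≡ σ w
∈-mapSet⁻ σ X p = ∈-map⁻ σ (∈-fromList⁻ _ p)

∈-∪⁺ˡ : ∀ X Y {v} → v ∈ₛ X → v ∈ₛ (X ∪ₛ Y)
∈-∪⁺ˡ X Y p = ∈-fromList⁺ (∈-++⁺ˡ p)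

∈-∪⁺ʳ : ∀ X Y {v} → v ∈ₛ Y → v ∈ₛ (X ∪ₛ Y)
∈-∪⁺ʳ X Y p = ∈-fromList⁺ (∈-++⁺ʳ (elems X) p)

∈-∪⁻ : ∀ X Y {v} → v ∈ₛ (X ∪ₛ Y) → v ∈ₛ X ⊎ v ∈ₛ Y
∈-∪⁻ X Y p = ∈-++⁻ (elems X) (∈-fromList⁻ _ p)

∈-delete⁺ : ∀ X {v w} → w ∈ₛ X → w ≢ v → w ∈ₛ (X -ₛ v)
∈-delete⁺ X {v} p n = ∈-fromList⁺ (∈-filter⁺ (λ w → ¬? (w ≟ v)) p n)

∈-delete⁻ : ∀ X {v w} → w ∈ₛ (X -ₛ v) → w ∈ₛ X × w ≢ v
∈-delete⁻ X {v} p = ∈-filter⁻ (λ w → ¬? (w ≟ v)) {xs = elems X} (∈-fromList⁻ _ p)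

sorted-ext : ∀ {xs ys} → AllPairs _≺_ xs → AllPairs _≺_ ys →
             (∀ {v} → v ∈ₗ xs → v ∈ₗ ys) → (∀ {v} → v ∈ₗ ys → v ∈ₗ xs) → xs ≡ ys
sorted-ext {[]} {[]} _ _ _ _ = refl
sorted-ext {[]} {y ∷ ys} _ _ _ g = case g (here refl) of λ ()
sorted-ext {x ∷ xs} {[]} _ _ f _ = case f (here refl) of λ ()
sorted-ext {x ∷ xs} {y ∷ ys} (x≺ ∷ p) (y≺ ∷ q) f g =
  cong₂ _∷_ x≡y (sorted-ext p q tail⊆ tail⊇)
  where
  x≡y : x ≡ y
  x≡y with f (here refl) | g (here refl)
  ... | here e  | _       = e
  ... | there _ | here e  = sym e
  ... | there r | there s = contradiction (All.lookup y≺ r) (ℕₚ.<-asym (All.lookup x≺ s))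
  tail⊆ : ∀ {v} → v ∈ₗ xs → v ∈ₗ ys
  tail⊆ r with f (there r)
  ... | there s = s
  ... | here refl = contradiction (All.lookup x≺ r) (ℕₚ.<-irrefl (cong key x≡y))
  tail⊇ : ∀ {v} → v ∈ₗ ys → v ∈ₗ xs
  tail⊇ r with g (there r)
  ... | there s = s
  ... | here refl = contradiction (All.lookup y≺ r) (ℕₚ.<-irrefl (cong key (sym x≡y)))

-- A strictly increasing list is determined by its members. The field `sorted` is irrelevant, so it
-- is recomputed from the decidability of the order, and equality of `elems` suffices.
VarSet-ext : ∀ {X Y} → (∀ {v} → v ∈ₛ X → v ∈ₛ Y) → (∀ {v} → v ∈ₛ Y → v ∈ₛ X) → X ≡ Y
VarSet-ext {X} {Y} f g = eq (sorted-ext (pairs X) (pairs Y) f g)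
  where
  pairs : ∀ Z → AllPairs _≺_ (elems Z)
  pairs (mkSet zs l) = Linked⇒AllPairs ℕₚ.<-trans
    (recompute (linked? (λ v w → key v ℕₚ.<? key w) zs) l)
  eq : ∀ {X Y} → elems X ≡ elems Y → X ≡ Y
  eq refl = refl

mapSet-id : ∀ {σ} X → (∀ {v} → v ∈ₛ X → σ v ≡ v) → mapSet σ X ≡ X
mapSet-id {σ} X fix = VarSet-ext
  (λ p → let _ , q , e = ∈-mapSet⁻ σ X p in subst (_∈ₛ X) (sym (trans e (fix q))) q)
  (λ p → subst (_∈ₛ mapSet σ X) (fix p) (∈-mapSet⁺ σ X p))

mapSet-cong : ∀ {σ τ} X → (∀ {v} → v ∈ₛ X → σ v ≡ τ v) → mapSet σ X ≡ mapSet τ X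
mapSet-cong {σ} {τ} X h = VarSet-ext
  (λ p → let _ , q , e = ∈-mapSet⁻ σ X p in subst (_∈ₛ mapSet τ X) (sym (trans e (h q))) (∈-mapSet⁺ τ X q))
  (λ p → let _ , q , e = ∈-mapSet⁻ τ X p in subst (_∈ₛ mapSet σ X) (trans (h q) (sym e)) (∈-mapSet⁺ σ X q))

mapSet-∘ : ∀ σ τ X → mapSet σ (mapSet τ X) ≡ mapSet (σ ∘ τ) X
mapSet-∘ σ τ X = VarSet-ext
  (λ p → let _ , q , e = ∈-mapSet⁻ σ (mapSet τ X) p ; _ , r , e′ = ∈-mapSet⁻ τ X q in
     subst (_∈ₛ mapSet (σ ∘ τ) X) (sym (trans e (cong σ e′))) (∈-mapSet⁺ (σ ∘ τ) X r))
  (λ p → let _ , q , e = ∈-mapSet⁻ (σ ∘ τ) X p in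
     subst (_∈ₛ mapSet σ (mapSet τ X)) (sym e) (∈-mapSet⁺ σ (mapSet τ X) (∈-mapSet⁺ τ X q)))

mapSet-insert : ∀ σ v X → mapSet σ (insert v X) ≡ insert (σ v) (mapSet σ X)
mapSet-insert σ v X = VarSet-ext
  (λ p → let _ , q , e = ∈-mapSet⁻ σ (insert v X) p in
     subst (_∈ₛ insert (σ v) (mapSet σ X)) (sym e)
       (case ∈-insert⁻ X q of λ
         { (inj₁ w≡v) → subst (λ w → σ w ∈ₛ insert (σ v) (mapSet σ X)) (sym w≡v) (∈-insert⁺ˡ (mapSet σ X))
         ; (inj₂ r) → ∈-insert⁺ʳ (mapSet σ X) (∈-mapSet⁺ σ X r) }))
  (λ p → case ∈-insert⁻ (mapSet σ X) p of λ
     { (inj₁ refl) → ∈-mapSet⁺ σ (insert v X) (∈-insert⁺ˡ X)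
     ; (inj₂ q) → let _ , r , e = ∈-mapSet⁻ σ X q in
         subst (_∈ₛ mapSet σ (insert v X)) (sym e) (∈-mapSet⁺ σ (insert v X) (∈-insert⁺ʳ X r)) })

∈-mapMaybe⁺ : ∀ {A B : Set} (f : A → Maybe B) {xs x y} → x ∈ₗ xs → f x ≡ just y → y ∈ₗ mapMaybe f xs
∈-mapMaybe⁺ f {x ∷ xs} (here refl) e rewrite e = here refl
∈-mapMaybe⁺ f {x ∷ xs} (there p) e with f x
... | just _  = there (∈-mapMaybe⁺ f p e)
... | nothing = ∈-mapMaybe⁺ f p e

∈-mapMaybe⁻ : ∀ {A B : Set} (f : A → Maybe B) xs {y} → y ∈ₗ mapMaybe f xs → ∃ λ x → x ∈ₗ xs × f x ≡ just y
∈-mapMaybe⁻ f (x ∷ xs) p with f x in eq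
∈-mapMaybe⁻ f (x ∷ xs) (here refl) | just _ = x , here refl , eq
∈-mapMaybe⁻ f (x ∷ xs) (there p) | just _ =
  let z , q , e = ∈-mapMaybe⁻ f xs p in z , there q , e
∈-mapMaybe⁻ f (x ∷ xs) p | nothing =
  let z , q , e = ∈-mapMaybe⁻ f xs p in z , there q , e

∈-wits⁺ : ∀ φ {a} → wit a ∈ₛ fv φ → wit a ∈ₛ wits φ
∈-wits⁺ φ p = ∈-fromList⁺ (∈-map⁺ wit (∈-mapMaybe⁺ witIndex p refl))

∈-wits⁻ : ∀ φ {v} → v ∈ₛ wits φ → v ∈ₛ fv φ × ∃ λ a → v ≡ wit a
∈-wits⁻ φ p with ∈-map⁻ wit (∈-fromList⁻ (map wit (mapMaybe witIndex (elems (fv φ)))) p)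
... | a , q , refl with ∈-mapMaybe⁻ witIndex (elems (fv φ)) q
... | wit .a , r , refl = r , a , refl

∈-wits-wit : ∀ φ {a} → wit a ∈ₛ wits φ → wit a ∈ₛ fv φ
∈-wits-wit φ p = proj₁ (∈-wits⁻ φ p)

basic∉wits : ∀ φ {x} → ¬ (basic x ∈ₛ wits φ)
basic∉wits φ p = case proj₂ (∈-wits⁻ φ p) of λ ()

wits-cong : ∀ φ ψ → (∀ {a} → wit a ∈ₛ fv φ → wit a ∈ₛ fv ψ) →
            (∀ {a} → wit a ∈ₛ fv ψ → wit a ∈ₛ fv φ) → wits φ ≡ wits ψ
wits-cong φ ψ f g = VarSet-ext (half φ ψ f) (half ψ φ g)
  where
  half : ∀ φ ψ → (∀ {a} → wit a ∈ₛ fv φ → wit a ∈ₛ fv ψ) → ∀ {v} → v ∈ₛ wits φ → v ∈ₛ wits ψ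
  half φ ψ f p with ∈-wits⁻ φ p
  ... | q , a , refl = ∈-wits⁺ ψ (f q)

-- Substitution

except-≡ : ∀ x σ {v} → v ≡ basic x → except x σ v ≡ v
except-≡ x σ {v} e rewrite dec-true (v ≟ basic x) e = refl

except-≢ : ∀ x σ {v} → v ≢ basic x → except x σ v ≡ σ v
except-≢ x σ {v} n rewrite dec-false (v ≟ basic x) n = refl

restrict-∈ : ∀ X σ {v} → v ∈ₛ X → restrict X σ v ≡ σ v
restrict-∈ X σ {v} p rewrite dec-true (v ∈ₛ? X) p = refl

restrict-∉ : ∀ X σ {v} → ¬ (v ∈ₛ X) → restrict X σ v ≡ v
restrict-∉ X σ {v} n rewrite dec-false (v ∈ₛ? X) n = refl

single-≡ : ∀ x v → single x v (basic x) ≡ v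
single-≡ x v rewrite dec-true (basic x ≟ basic x) refl = refl

single-≢ : ∀ x v {w} → w ≢ basic x → single x v w ≡ w
single-≢ x v {w} n rewrite dec-false (w ≟ basic x) n = refl

∈-toList-map⁻ : ∀ {n} (σ : Var → Var) (vs : Vec Var n) {v} → v ∈ₗ toList (Vec.map σ vs) →
                ∃ λ w → w ∈ₗ toList vs × v ≡ σ w
∈-toList-map⁻ σ (w ∷ vs) (here e) = w , here refl , e
∈-toList-map⁻ σ (w ∷ vs) (there p) = let u , q , e = ∈-toList-map⁻ σ vs p in u , there q , e

vec-map-cong : ∀ {n} {σ τ : Var → Var} (vs : Vec Var n) → (∀ {v} → v ∈ₗ toList vs → σ v ≡ τ v) →
               Vec.map σ vs ≡ Vec.map τ vs
vec-map-cong [] h = refl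
vec-map-cong (v ∷ vs) h = cong₂ _∷_ (h (here refl)) (vec-map-cong vs (h ∘ there))

fv-sub⁻ : ∀ σ φ {v} → v ∈ₛ fv (sub σ φ) → ∃ λ w → w ∈ₛ fv φ × v ≡ σ w
fv-sub⁻ σ (atom P vs) p =
  let w , q , e = ∈-toList-map⁻ σ vs (∈-fromList⁻ _ p) in w , ∈-fromList⁺ q , e
fv-sub⁻ σ (φ ⇒ ψ) p with ∈-∪⁻ (fv (sub σ φ)) (fv (sub σ ψ)) p
... | inj₁ q = let w , r , e = fv-sub⁻ σ φ q in w , ∈-∪⁺ˡ (fv φ) (fv ψ) r , e
... | inj₂ q = let w , r , e = fv-sub⁻ σ ψ q in w , ∈-∪⁺ʳ (fv φ) (fv ψ) r , e
fv-sub⁻ σ (∀' x φ) p with ∈-delete⁻ (fv (sub (except x σ) φ)) p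
... | q , v≢x with fv-sub⁻ (except x σ) φ q
... | w , r , e with w ≟ basic x
... | yes refl = contradiction e v≢x
... | no w≢x = w , ∈-delete⁺ (fv φ) r w≢x , e
fv-sub⁻ σ (t ∶[ X ] φ) p = ∈-mapSet⁻ σ X p

sub-cong : ∀ {σ τ} φ → (∀ {v} → v ∈ₛ fv φ → σ v ≡ τ v) → sub σ φ ≡ sub τ φ
sub-cong (atom P vs) h = cong (atom P) (vec-map-cong vs (h ∘ ∈-fromList⁺))
sub-cong ⊥' h = refl
sub-cong (φ ⇒ ψ) h = cong₂ _⇒_
  (sub-cong φ (h ∘ ∈-∪⁺ˡ (fv φ) (fv ψ))) (sub-cong ψ (h ∘ ∈-∪⁺ʳ (fv φ) (fv ψ)))
sub-cong {σ} {τ} (∀' x φ) h = cong (∀' x) (sub-cong φ agree)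
  where
  agree : ∀ {v} → v ∈ₛ fv φ → except x σ v ≡ except x τ v
  agree {v} p with v ≟ basic x
  ... | yes _ = refl
  ... | no n = h (∈-delete⁺ (fv φ) p n)
sub-cong {σ} {τ} (t ∶[ X ] φ) h = cong₂ (t ∶[_]_) (mapSet-cong X h) (sub-cong φ agree)
  where
  agree : ∀ {v} → v ∈ₛ fv φ → restrict X σ v ≡ restrict X τ v
  agree {v} _ with v ∈ₛ? X
  ... | yes p = h p
  ... | no _ = refl

sub-id : ∀ {σ} φ → (∀ {v} → v ∈ₛ fv φ → σ v ≡ v) → sub σ φ ≡ φ
sub-id φ h = trans (sub-cong φ h) (sub-identity φ)
  where
  sub-identity : ∀ φ → sub id φ ≡ φ
  sub-identity (atom P vs) = cong (atom P) (Vecₚ.map-id vs)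
  sub-identity ⊥' = refl
  sub-identity (φ ⇒ ψ) = cong₂ _⇒_ (sub-identity φ) (sub-identity ψ)
  sub-identity (∀' x φ) = cong (∀' x) (trans (sub-cong φ fixed) (sub-identity φ))
    where
    fixed : ∀ {v} → v ∈ₛ fv φ → except x id v ≡ v
    fixed {v} _ with v ≟ basic x
    ... | yes _ = refl
    ... | no _ = refl
  sub-identity (t ∶[ X ] φ) = cong₂ (t ∶[_]_) (mapSet-id X λ _ → refl)
    (trans (sub-cong φ fixed) (sub-identity φ))
    where
    fixed : ∀ {v} → v ∈ₛ fv φ → restrict X id v ≡ v
    fixed {v} _ with v ∈ₛ? X
    ... | yes _ = refl
    ... | no _ = refl

single-self : ∀ x v → single x (basic x) v ≡ v
single-self x v with v ≟ basic x
... | yes refl = refl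
... | no _ = refl

-- Henkin φ computes by recursion on φ, so φ cannot be inferred from it; the
-- wrapper makes it inferable.
record IsHenkin (φ : Fml) : Set where
  constructor hk
  field
    henkin : Henkin φ

Henkin-⊥ : IsHenkin ⊥'
Henkin-⊥ = hk λ _ → tt

Henkin-⇒ : ∀ {φ ψ} → IsHenkin φ → IsHenkin ψ → IsHenkin (φ ⇒ ψ)
Henkin-⇒ (hk h) (hk k) = hk λ a → h a , k a

Henkin-∀ : ∀ x {φ} → IsHenkin φ → IsHenkin (∀' x φ)
Henkin-∀ x (hk h) = hk λ a → (λ ()) , h a

Henkin-∶ : ∀ {t X φ} → IsHenkin φ → (∀ {a} → wit a ∈ₛ fv φ → wit a ∈ₛ X) → IsHenkin (t ∶[ X ] φ)
Henkin-∶ (hk h) w = hk λ a → (λ _ ()) , h a , w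

Henkin-wits : ∀ {t φ} → IsHenkin φ → IsHenkin (t ∶[ wits φ ] φ)
Henkin-wits {φ = φ} h = Henkin-∶ h (∈-wits⁺ φ)

Henkin-⇒ˡ : ∀ {φ ψ} → IsHenkin (φ ⇒ ψ) → IsHenkin φ
Henkin-⇒ˡ (hk h) = hk λ a → proj₁ (h a)

Henkin-⇒ʳ : ∀ {φ ψ} → IsHenkin (φ ⇒ ψ) → IsHenkin ψ
Henkin-⇒ʳ (hk h) = hk λ a → proj₂ (h a)

Henkin-∀⁻ : ∀ {x φ} → IsHenkin (∀' x φ) → IsHenkin φ
Henkin-∀⁻ (hk h) = hk λ a → proj₂ (h a)

Henkin-∶⁻ : ∀ {t X φ} → IsHenkin (t ∶[ X ] φ) → IsHenkin φ
Henkin-∶⁻ (hk h) = hk λ a → proj₁ (proj₂ (h a))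

Henkin-subscript : ∀ {t X φ} → IsHenkin (t ∶[ X ] φ) → ∀ {a} → wit a ∈ₛ fv φ → wit a ∈ₛ X
Henkin-subscript (hk h) {a} = proj₂ (proj₂ (h a))

-- `restrict X σ` moves only members of `X`, and `mapSet` puts their images into the subscript. A
-- witness of the body that is not moved lies in `X` because the formula was Henkin before.
Henkin-sub : ∀ σ φ → IsHenkin φ → IsHenkin (sub σ φ)
Henkin-sub σ (atom P vs) h = hk λ _ → tt
Henkin-sub σ ⊥' h = hk λ _ → tt
Henkin-sub σ (φ ⇒ ψ) h = Henkin-⇒ (Henkin-sub σ φ (Henkin-⇒ˡ h)) (Henkin-sub σ ψ (Henkin-⇒ʳ h))
Henkin-sub σ (∀' x φ) h = Henkin-∀ x (Henkin-sub (except x σ) φ (Henkin-∀⁻ h))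
Henkin-sub σ (t ∶[ X ] φ) h = Henkin-∶ (Henkin-sub (restrict X σ) φ (Henkin-∶⁻ h)) sub⊆
  where
  sub⊆ : ∀ {a} → wit a ∈ₛ fv (sub (restrict X σ) φ) → wit a ∈ₛ mapSet σ X
  sub⊆ p with fv-sub⁻ (restrict X σ) φ p
  ... | w , q , e with w ∈ₛ? X
  ... | yes r = subst (_∈ₛ mapSet σ X) (sym e) (∈-mapSet⁺ σ X r)
  ... | no n = contradiction (subst (_∈ₛ X) e (Henkin-subscript h (subst (_∈ₛ fv φ) (sym e) q))) n

-- Quantifiers bind basic variables only, and a Henkin subscript contains every witness free in the
-- body, so witnesses are never captured.
FreeFor-wit : ∀ a x φ → IsHenkin φ → FreeFor (wit a) x φ
FreeFor-wit a x (atom P vs) h = tt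
FreeFor-wit a x ⊥' h = tt
FreeFor-wit a x (φ ⇒ ψ) h = FreeFor-wit a x φ (Henkin-⇒ˡ h) , FreeFor-wit a x ψ (Henkin-⇒ʳ h)
FreeFor-wit a x (∀' z φ) h = inj₂ ((λ ()) , FreeFor-wit a x φ (Henkin-∀⁻ h))
FreeFor-wit a x (t ∶[ X ] φ) h = inj₂ (FreeFor-wit a x φ (Henkin-∶⁻ h) , Henkin-subscript h)

FreeFor-self : ∀ x φ → FreeFor (basic x) x φ
FreeFor-self x (atom P vs) = tt
FreeFor-self x ⊥' = tt
FreeFor-self x (φ ⇒ ψ) = FreeFor-self x φ , FreeFor-self x ψ
FreeFor-self x (∀' z φ) with basic x ≟ basic z
... | yes refl = inj₁ λ p → proj₂ (∈-delete⁻ (fv φ) p) refl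
... | no n = inj₂ (n , FreeFor-self x φ)
FreeFor-self x (t ∶[ X ] φ) with basic x ∈ₛ? X
... | yes p = inj₂ (FreeFor-self x φ , λ _ → p)
... | no n = inj₁ n

IsWit : Var → Set
IsWit v = ∃ λ a → v ≡ wit a

-- Without renaming of bound variables, composition fails as soon as an image of `τ` is captured.
-- Here a changed variable becomes a witness, which no quantifier binds and which no Henkin
-- subscript hides.
sub-∘ : ∀ {σ τ} φ → IsHenkin φ → (∀ v → τ v ≡ v ⊎ IsWit (τ v)) →
        sub σ (sub τ φ) ≡ sub (σ ∘ τ) φ
sub-∘ {σ} {τ} (atom P vs) h g = cong (atom P) (sym (Vecₚ.map-∘ σ τ vs))
sub-∘ ⊥' h g = refl
sub-∘ (φ ⇒ ψ) h g = cong₂ _⇒_ (sub-∘ φ (Henkin-⇒ˡ h) g) (sub-∘ ψ (Henkin-⇒ʳ h) g)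
sub-∘ {σ} {τ} (∀' x φ) h g = cong (∀' x)
  (trans (sub-∘ φ (Henkin-∀⁻ h) g′) (sub-cong φ λ {v} _ → agree v))
  where
  g′ : ∀ v → except x τ v ≡ v ⊎ IsWit (except x τ v)
  g′ v with v ≟ basic x
  ... | yes _ = inj₁ refl
  ... | no _ = g v
  agree : ∀ v → except x σ (except x τ v) ≡ except x (σ ∘ τ) v
  agree v with v ≟ basic x
  ... | yes e = except-≡ x σ e
  ... | no n = except-≢ x σ λ e → case g v of λ
    { (inj₁ τv≡v) → n (trans (sym τv≡v) e)
    ; (inj₂ (_ , τv≡a)) → case trans (sym e) τv≡a of λ () }
sub-∘ {σ} {τ} (t ∶[ X ] φ) h g = cong₂ (t ∶[_]_) (mapSet-∘ σ τ X)
  (trans (sub-∘ φ (Henkin-∶⁻ h) g′) (sub-cong φ agree))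
  where
  g′ : ∀ v → restrict X τ v ≡ v ⊎ IsWit (restrict X τ v)
  g′ v with v ∈ₛ? X
  ... | yes _ = g v
  ... | no _ = inj₁ refl
  agree : ∀ {v} → v ∈ₛ fv φ → restrict (mapSet τ X) σ (restrict X τ v) ≡ restrict X (σ ∘ τ) v
  agree {v} p with v ∈ₛ? X
  ... | yes q = restrict-∈ (mapSet τ X) σ (∈-mapSet⁺ τ X q)
  ... | no n = restrict-∉ (mapSet τ X) σ λ q → let u , r , e = ∈-mapSet⁻ τ X q in
    case g u of λ
      { (inj₁ τu≡u) → n (subst (_∈ₛ X) (sym (trans e τu≡u)) r)
      ; (inj₂ (a , τu≡a)) → n (subst (_∈ₛ X) (sym (trans e τu≡a))
          (Henkin-subscript h (subst (_∈ₛ fv φ) (trans e τu≡a) p))) }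

-- Renaming of all variables, free and bound

module Renaming (f g : ℕ → ℕ) where

  renV : Var → Var
  renV (basic x) = basic (f x)
  renV (wit a)   = basic (g a)

  renT : Term → Term
  renT (jvar i)  = jvar i
  renT (const c) = const c
  renT (t · s)   = renT t · renT s
  renT (t ⊹ s)   = renT t ⊹ renT s
  renT (! t)     = ! renT t
  renT (b t)     = b (renT t)
  renT (gen x t) = gen (f x) (renT t)

  ren : Fml → Fml
  ren (atom P vs)  = atom P (Vec.map renV vs)
  ren ⊥'           = ⊥'
  ren (φ ⇒ ψ)      = ren φ ⇒ ren ψ
  ren (∀' x φ)     = ∀' (f x) (ren φ)
  ren (t ∶[ X ] φ) = renT t ∶[ mapSet renV X ] ren φ

  BasicFml-ren : ∀ φ → BasicFml (ren φ)
  BasicFml-ren (atom P vs) = all vs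
    where
    isBasicVar : ∀ v → IsBasicVar (renV v)
    isBasicVar (basic x) = basic (f x)
    isBasicVar (wit a)   = basic (g a)
    all : ∀ {n} (vs : Vec Var n) → VecAll.All IsBasicVar (Vec.map renV vs)
    all [] = []
    all (v ∷ vs) = isBasicVar v ∷ all vs
  BasicFml-ren ⊥' = tt
  BasicFml-ren (φ ⇒ ψ) = BasicFml-ren φ , BasicFml-ren ψ
  BasicFml-ren (∀' x φ) = BasicFml-ren φ
  BasicFml-ren (t ∶[ X ] φ) =
    All.tabulate (λ p → isBasicVar (∈-mapSet⁻ renV X p)) , BasicFml-ren φ
    where
    isBasicVar : ∀ {v} → (∃ λ w → w ∈ₛ X × v ≡ renV w) → IsBasicVar v
    isBasicVar (basic x , _ , refl) = basic (f x)
    isBasicVar (wit a , _ , refl)   = basic (g a)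

  fv-ren⁻ : ∀ φ {v} → v ∈ₛ fv (ren φ) → ∃ λ w → w ∈ₛ fv φ × v ≡ renV w
  fv-ren⁻ (atom P vs) p =
    let w , q , e = ∈-toList-map⁻ renV vs (∈-fromList⁻ _ p) in w , ∈-fromList⁺ q , e
  fv-ren⁻ (φ ⇒ ψ) p with ∈-∪⁻ (fv (ren φ)) (fv (ren ψ)) p
  ... | inj₁ q = let w , r , e = fv-ren⁻ φ q in w , ∈-∪⁺ˡ (fv φ) (fv ψ) r , e
  ... | inj₂ q = let w , r , e = fv-ren⁻ ψ q in w , ∈-∪⁺ʳ (fv φ) (fv ψ) r , e
  fv-ren⁻ (∀' x φ) p with ∈-delete⁻ (fv (ren φ)) p
  ... | q , v≢fx with fv-ren⁻ φ q
  ... | w , r , e = w , ∈-delete⁺ (fv φ) r (λ w≡x → v≢fx (trans e (cong renV w≡x))) , e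
  fv-ren⁻ (t ∶[ X ] φ) p = ∈-mapSet⁻ renV X p

  module _ (renV-injective : ∀ {v w} → renV v ≡ renV w → v ≡ w) where

    ∈-mapSet-renV : ∀ X {v} → renV v ∈ₛ mapSet renV X → v ∈ₛ X
    ∈-mapSet-renV X p =
      let _ , q , e = ∈-mapSet⁻ renV X p in subst (_∈ₛ X) (sym (renV-injective e)) q

    ∈-fv-ren : ∀ φ {v} → renV v ∈ₛ fv (ren φ) → v ∈ₛ fv φ
    ∈-fv-ren φ p = let _ , q , e = fv-ren⁻ φ p in subst (_∈ₛ fv φ) (sym (renV-injective e)) q

    -- Injectivity makes `except` and `restrict` take the same decision before and after renaming.
    ren-sub : ∀ {σ σ′} φ → (∀ w → σ′ (renV w) ≡ renV (σ w)) → ren (sub σ φ) ≡ sub σ′ (ren φ)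
    ren-sub (atom P vs) h = cong (atom P) (commute vs)
      where
      commute : ∀ {n} (vs : Vec Var n) → Vec.map renV (Vec.map _ vs) ≡ Vec.map _ (Vec.map renV vs)
      commute [] = refl
      commute (v ∷ vs) = cong₂ _∷_ (sym (h v)) (commute vs)
    ren-sub ⊥' h = refl
    ren-sub (φ ⇒ ψ) h = cong₂ _⇒_ (ren-sub φ h) (ren-sub ψ h)
    ren-sub {σ} {σ′} (∀' x φ) h = cong (∀' (f x)) (ren-sub φ commute)
      where
      commute : ∀ w → except (f x) σ′ (renV w) ≡ renV (except x σ w)
      commute w with w ≟ basic x
      ... | yes e = except-≡ (f x) σ′ (cong renV e)
      ... | no n = trans (except-≢ (f x) σ′ (n ∘ renV-injective)) (h w)
    ren-sub {σ} {σ′} (t ∶[ X ] φ) h = cong₂ (renT t ∶[_]_)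
      (trans (mapSet-∘ renV σ X)
        (trans (mapSet-cong X λ {v} _ → sym (h v)) (sym (mapSet-∘ σ′ renV X))))
      (ren-sub φ commute)
      where
      commute : ∀ w → restrict (mapSet renV X) σ′ (renV w) ≡ renV (restrict X σ w)
      commute w with w ∈ₛ? X
      ... | yes p = trans (restrict-∈ (mapSet renV X) σ′ (∈-mapSet⁺ renV X p)) (h w)
      ... | no n = restrict-∉ (mapSet renV X) σ′ (n ∘ ∈-mapSet-renV X)

    ren-single : ∀ x v w → single (f x) (renV v) (renV w) ≡ renV (single x v w)
    ren-single x v w with w ≟ basic x
    ... | yes refl = single-≡ (f x) (renV v)
    ... | no n = single-≢ (f x) (renV v) (n ∘ renV-injective)

    FreeFor-ren : ∀ {v x} φ → FreeFor v x φ → FreeFor (renV v) (f x) (ren φ)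
    FreeFor-ren (atom P vs) _ = tt
    FreeFor-ren ⊥' _ = tt
    FreeFor-ren (φ ⇒ ψ) (p , q) = FreeFor-ren φ p , FreeFor-ren ψ q
    FreeFor-ren (∀' z φ) (inj₁ n) = inj₁ (n ∘ ∈-fv-ren (∀' z φ))
    FreeFor-ren (∀' z φ) (inj₂ (n , p)) = inj₂ (n ∘ renV-injective , FreeFor-ren φ p)
    FreeFor-ren (t ∶[ X ] φ) (inj₁ n) = inj₁ (n ∘ ∈-mapSet-renV X)
    FreeFor-ren (t ∶[ X ] φ) (inj₂ (p , w)) =
      inj₂ (FreeFor-ren φ p , λ q → ∈-mapSet⁺ renV X (w (∈-fv-ren φ q)))

    -- The axioms are schemes whose side conditions speak of non-membership and of being free for a
    -- variable. Both survive an injective renaming that acts uniformly on free and bound variables.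
    Axiom-ren : ∀ {φ} → Axiom φ → Axiom (ren φ)
    Axiom-ren A1-K = A1-K
    Axiom-ren A1-S = A1-S
    Axiom-ren A1-DN = A1-DN
    Axiom-ren (A1-∀E {x} {v} {φ} p) rewrite ren-sub φ (ren-single x v) = A1-∀E (FreeFor-ren φ p)
    Axiom-ren (A1-∀D {φ = φ} n) = A1-∀D (n ∘ ∈-fv-ren φ)
    Axiom-ren (A2 {X = X} {y} {φ} n) rewrite mapSet-insert renV y X = A2 (n ∘ ∈-fv-ren φ)
    Axiom-ren (A3 {X = X} {y}) rewrite mapSet-insert renV y X = A3
    Axiom-ren B1 = B1
    Axiom-ren B2 = B2
    Axiom-ren B3ˡ = B3ˡ
    Axiom-ren B3ʳ = B3ʳ
    Axiom-ren B4 = B4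
    Axiom-ren (B5 {X = X} n) = B5 (n ∘ ∈-mapSet-renV X)
    Axiom-ren (Bb {X = X} {y}) rewrite mapSet-insert renV (basic y) X = Bb

-- A strict upper bound for the indices of all basic variables of a formula

boundV : Var → ℕ
boundV (basic x) = suc x
boundV (wit a)   = 0

boundL : List Var → ℕ
boundL = foldr (λ v → boundV v ⊔_) 0

boundT : Term → ℕ
boundT (jvar i)  = 0
boundT (const c) = 0
boundT (t · s)   = boundT t ⊔ boundT s
boundT (t ⊹ s)   = boundT t ⊔ boundT s
boundT (! t)     = boundT t
boundT (b t)     = boundT t
boundT (gen x t) = suc x ⊔ boundT t

bound : Fml → ℕ
bound (atom P vs)  = boundL (toList vs)
bound ⊥'           = 0
bound (φ ⇒ ψ)      = bound φ ⊔ bound ψ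
bound (∀' x φ)     = suc x ⊔ bound φ
bound (t ∶[ X ] φ) = boundT t ⊔ (boundL (elems X) ⊔ bound φ)

boundL-∈ : ∀ {N x} vs → boundL vs ≤ N → basic x ∈ₗ vs → x < N
boundL-∈ (v ∷ vs) le (here refl) = ℕₚ.m⊔n≤o⇒m≤o (boundV v) (boundL vs) le
boundL-∈ (v ∷ vs) le (there p) = boundL-∈ vs (ℕₚ.m⊔n≤o⇒n≤o (boundV v) _ le) p

bound-fv : ∀ {N x} φ → bound φ ≤ N → basic x ∈ₛ fv φ → x < N
bound-fv (atom P vs) le p = boundL-∈ (toList vs) le (∈-fromList⁻ _ p)
bound-fv (φ ⇒ ψ) le p with ∈-∪⁻ (fv φ) (fv ψ) p
... | inj₁ q = bound-fv φ (ℕₚ.m⊔n≤o⇒m≤o _ (bound ψ) le) q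
... | inj₂ q = bound-fv ψ (ℕₚ.m⊔n≤o⇒n≤o (bound φ) _ le) q
bound-fv (∀' x φ) le p = bound-fv φ (ℕₚ.m⊔n≤o⇒n≤o (suc x) _ le) (proj₁ (∈-delete⁻ (fv φ) p))
bound-fv (t ∶[ X ] φ) le p =
  boundL-∈ (elems X) (ℕₚ.m⊔n≤o⇒m≤o _ (bound φ) (ℕₚ.m⊔n≤o⇒n≤o (boundT t) _ le)) p

-- Basic variables below N stay fixed; all others move injectively to basic
-- variables that are not below N, which makes room for the witness variables.
module Freshen (em : ExcludedMiddle 0ℓ) (N : ℕ) where

  move : ℕ → ℕ
  move x = if does (x ℕₚ.<? N) then x else N + key (basic x)

  open Renaming move (λ a → N + key (wit a)) public

  move-< : ∀ {x} → x < N → move x ≡ x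
  move-< {x} lt rewrite dec-true (x ℕₚ.<? N) lt = refl

  move-≥ : ∀ {x} → ¬ (x < N) → move x ≡ N + key (basic x)
  move-≥ {x} ge rewrite dec-false (x ℕₚ.<? N) ge = refl

  basic-injective : ∀ {x y} → Var.basic x ≡ basic y → x ≡ y
  basic-injective refl = refl

  renV-fixed-or-moved : ∀ v → (renV v ≡ v × ∃ λ x → v ≡ basic x × x < N) ⊎ renV v ≡ basic (N + key v)
  renV-fixed-or-moved (wit a) = inj₂ refl
  renV-fixed-or-moved (basic x) with x ℕₚ.<? N
  ... | yes lt = inj₁ (cong basic (move-< lt) , x , refl , lt)
  ... | no ge = inj₂ (cong basic (move-≥ ge))

  N+≮N : ∀ {n} → ¬ (N + n < N)
  N+≮N = ℕₚ.≤⇒≯ (ℕₚ.m≤m+n N _)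

  renV-injective : ∀ {v w} → renV v ≡ renV w → v ≡ w
  renV-injective {v} {w} e with renV-fixed-or-moved v | renV-fixed-or-moved w
  ... | inj₁ (p , _) | inj₁ (q , _) = trans (sym p) (trans e q)
  ... | inj₂ p | inj₂ q =
    key-injective (ℕₚ.+-cancelˡ-≡ N _ _ (basic-injective (trans (sym p) (trans e q))))
  ... | inj₁ (p , x , refl , lt) | inj₂ q =
    contradiction (subst (_< N) (basic-injective (trans (sym p) (trans e q))) lt) N+≮N
  ... | inj₂ p | inj₁ (q , x , refl , lt) =
    contradiction (subst (_< N) (basic-injective (trans (sym q) (trans (sym e) p))) lt) N+≮N

  renT-fixed : ∀ t → boundT t ≤ N → renT t ≡ t
  renT-fixed (jvar i) le = refl
  renT-fixed (const c) le = refl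
  renT-fixed (t · s) le = cong₂ _·_ (renT-fixed t (ℕₚ.m⊔n≤o⇒m≤o _ (boundT s) le))
    (renT-fixed s (ℕₚ.m⊔n≤o⇒n≤o (boundT t) _ le))
  renT-fixed (t ⊹ s) le = cong₂ _⊹_ (renT-fixed t (ℕₚ.m⊔n≤o⇒m≤o _ (boundT s) le))
    (renT-fixed s (ℕₚ.m⊔n≤o⇒n≤o (boundT t) _ le))
  renT-fixed (! t) le = cong !_ (renT-fixed t le)
  renT-fixed (b t) le = cong b (renT-fixed t le)
  renT-fixed (gen x t) le = cong₂ gen (move-< (ℕₚ.m⊔n≤o⇒m≤o (suc x) (boundT t) le))
    (renT-fixed t (ℕₚ.m⊔n≤o⇒n≤o (suc x) _ le))

  -- Only free variables have to be restored: quantified variables, `gen` subscripts and basic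
  -- variables hidden by a subscript lie below `N` and were not moved. A hidden witness could not be
  -- restored, and the Henkin condition excludes it.
  sub-ren : ∀ κ φ → bound φ ≤ N → IsHenkin φ → (∀ {v} → v ∈ₛ fv φ → κ (renV v) ≡ v) →
            sub κ (ren φ) ≡ φ
  sub-ren κ (atom P vs) le h r = cong (atom P) (retract vs (r ∘ ∈-fromList⁺))
    where
    retract : ∀ {n} (vs : Vec Var n) → (∀ {v} → v ∈ₗ toList vs → κ (renV v) ≡ v) →
              Vec.map κ (Vec.map renV vs) ≡ vs
    retract [] r = refl
    retract (v ∷ vs) r = cong₂ _∷_ (r (here refl)) (retract vs (r ∘ there))
  sub-ren κ ⊥' le h r = refl
  sub-ren κ (φ ⇒ ψ) le h r = cong₂ _⇒_
    (sub-ren κ φ (ℕₚ.m⊔n≤o⇒m≤o _ (bound ψ) le) (Henkin-⇒ˡ h) (r ∘ ∈-∪⁺ˡ (fv φ) (fv ψ)))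
    (sub-ren κ ψ (ℕₚ.m⊔n≤o⇒n≤o (bound φ) _ le) (Henkin-⇒ʳ h) (r ∘ ∈-∪⁺ʳ (fv φ) (fv ψ)))
  sub-ren κ (∀' x φ) le h r rewrite move-< (ℕₚ.m⊔n≤o⇒m≤o (suc x) (bound φ) le) =
    cong (∀' x) (sub-ren (except x κ) φ (ℕₚ.m⊔n≤o⇒n≤o (suc x) _ le) (Henkin-∀⁻ h) retract)
    where
    fixed : renV (basic x) ≡ basic x
    fixed = cong basic (move-< (ℕₚ.m⊔n≤o⇒m≤o (suc x) (bound φ) le))
    retract : ∀ {v} → v ∈ₛ fv φ → except x κ (renV v) ≡ v
    retract {v} p with v ≟ basic x
    ... | yes refl = trans (except-≡ x κ fixed) fixed
    ... | no n = trans (except-≢ x κ λ e → n (renV-injective (trans e (sym fixed))))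
                       (r (∈-delete⁺ (fv φ) p n))
  sub-ren κ (t ∶[ X ] φ) le h r
    rewrite renT-fixed t (ℕₚ.m⊔n≤o⇒m≤o (boundT t) _ le) =
    cong₂ (t ∶[_]_) (trans (mapSet-∘ κ renV X) (mapSet-id X r))
      (sub-ren (restrict (mapSet renV X) κ) φ le′ (Henkin-∶⁻ h) retract)
    where
    le′ : bound φ ≤ N
    le′ = ℕₚ.m⊔n≤o⇒n≤o (boundL (elems X)) _ (ℕₚ.m⊔n≤o⇒n≤o (boundT t) _ le)
    retract : ∀ {v} → v ∈ₛ fv φ → restrict (mapSet renV X) κ (renV v) ≡ v
    retract {v} p with v ∈ₛ? X
    ... | yes q = trans (restrict-∈ (mapSet renV X) κ (∈-mapSet⁺ renV X q)) (r q)
    retract {wit a} p | no n = contradiction (Henkin-subscript h p) n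
    retract {basic x} p | no n =
      trans (restrict-∉ (mapSet renV X) κ (n ∘ ∈-mapSet-renV renV-injective X))
            (cong basic (move-< (bound-fv φ le′ p)))

  -- The partial inverse of the placement of witnesses. Being the inverse of a function, it never
  -- gives the same witness to two indices, as `HenkinSpec` demands.
  witOf : ℕ → Maybe ℕ
  witOf n with em {∃ λ a → n ≡ N + key (wit a)}
  ... | yes (a , _) = just a
  ... | no _ = nothing

  witOf-just : ∀ {n a} → witOf n ≡ just a → n ≡ N + key (wit a)
  witOf-just {n} e with em {∃ λ a → n ≡ N + key (wit a)}
  witOf-just {n} refl | yes (a , e) = e
  witOf-just {n} () | no _

  replace-renV : ∀ {v} → (∀ {x} → v ≡ basic x → x < N) → replace witOf (renV v) ≡ v
  replace-renV {wit a} _ with em {∃ λ c → N + key (wit a) ≡ N + key (wit c)}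
  ... | yes (c , e) = sym (key-injective (ℕₚ.+-cancelˡ-≡ N _ _ e))
  ... | no n = contradiction (a , refl) n
  replace-renV {basic x} below rewrite move-< (below refl) with em {∃ λ c → x ≡ N + key (wit c)}
  ... | yes (c , e) = contradiction (subst (_< N) e (below refl)) N+≮N
  ... | no _ = refl

-- Lifting of axioms

fv-BasicFml : ∀ φ → BasicFml φ → ∀ {a} → ¬ (wit a ∈ₛ fv φ)
fv-BasicFml (atom P vs) bs p = go vs bs (∈-fromList⁻ _ p)
  where
  go : ∀ {n} (vs : Vec Var n) → VecAll.All IsBasicVar vs → ∀ {a} → ¬ (wit a ∈ₗ toList vs)
  go (._ ∷ vs) (() ∷ _) (here refl)
  go (_ ∷ vs) (_ ∷ bs) (there p) = go vs bs p
fv-BasicFml (φ ⇒ ψ) (p , q) r = [ fv-BasicFml φ p , fv-BasicFml ψ q ]′ (∈-∪⁻ (fv φ) (fv ψ) r)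
fv-BasicFml (∀' x φ) p q = fv-BasicFml φ p (proj₁ (∈-delete⁻ (fv φ) q))
fv-BasicFml (t ∶[ X ] φ) (p , _) q = case All.lookup p q of λ ()

BasicFml⇒Henkin : ∀ φ → BasicFml φ → IsHenkin φ
BasicFml⇒Henkin (atom P vs) p = hk λ _ → tt
BasicFml⇒Henkin ⊥' p = hk λ _ → tt
BasicFml⇒Henkin (φ ⇒ ψ) (p , q) = Henkin-⇒ (BasicFml⇒Henkin φ p) (BasicFml⇒Henkin ψ q)
BasicFml⇒Henkin (∀' x φ) p = Henkin-∀ x (BasicFml⇒Henkin φ p)
BasicFml⇒Henkin (t ∶[ X ] φ) (_ , p) =
  Henkin-∶ (BasicFml⇒Henkin φ p) (λ q → contradiction q (fv-BasicFml φ p))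

module _ (em : ExcludedMiddle 0ℓ) (CS : ConstSpec) (appropriate : AxiomaticallyAppropriate CS) where

  lift-axiom : ∀ {φ} → IsHenkin φ → Axiom φ → ∃ λ c → HenkinSpec CS (const c ∶[ wits φ ] φ)
  lift-axiom {φ} h A =
    let c , s = appropriate (BasicFml-ren φ) (Axiom-ren renV-injective A)
    in c , subst (λ ψ → HenkinSpec CS (const c ∶[ wits ψ ] ψ))
             (sub-ren (replace witOf) φ ℕₚ.≤-refl h
               (λ p → replace-renV λ { refl → bound-fv φ ℕₚ.≤-refl p }))
             (witnessed witOf s λ _ _ e e′ → trans (witOf-just e) (sym (witOf-just e′)))
    where open Freshen em (bound φ)

-- Derivability from hypotheses

module Derivability (CS : ConstSpec) where

  -- Parts of Henkin formulas are Henkin, so modus ponens stays in the language. Derivations thereby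
  -- certify the formulas that later axiom instances are built from.
  ⊢-Henkin : ∀ {φ} → CS ⊢ φ → IsHenkin φ
  ⊢-Henkin (ax h _) = hk h
  ⊢-Henkin (cs (witnessed {φ = φ} σ s _)) =
    Henkin-wits (Henkin-sub (replace σ) φ (BasicFml⇒Henkin φ (isBasic CS s)))
  ⊢-Henkin (mp d _) = Henkin-⇒ʳ (⊢-Henkin d)
  ⊢-Henkin (gen x d) = Henkin-∀ x (⊢-Henkin d)

  -- Generalization applies to theorems only, so that the deduction theorem holds.
  data Der (S : Pred Fml 0ℓ) : Fml → Set where
    hyp : ∀ {φ} → IsHenkin φ → φ ∈ S → Der S φ
    thm : ∀ {φ} → CS ⊢ φ → Der S φ
    app : ∀ {φ ψ} → Der S (φ ⇒ ψ) → Der S φ → Der S ψ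

  private variable
    S T : Pred Fml 0ℓ
    φ ψ θ χ : Fml
    t s : Term

  Der-Henkin : Der S φ → IsHenkin φ
  Der-Henkin (hyp h _) = h
  Der-Henkin (thm d)   = ⊢-Henkin d
  Der-Henkin (app d _) = Henkin-⇒ʳ (Der-Henkin d)

  bind : (∀ {φ} → IsHenkin φ → φ ∈ S → Der T φ) → Der S φ → Der T φ
  bind f (hyp h p) = f h p
  bind f (thm d)   = thm d
  bind f (app d e) = app (bind f d) (bind f e)

  mono : (∀ {φ} → φ ∈ S → φ ∈ T) → Der S φ → Der T φ
  mono f = bind λ h p → hyp h (f p)

  weaken : Der S φ → Der (S ∪ ｛ θ ｝) φ
  weaken = mono inj₁

  assumption : IsHenkin θ → Der (S ∪ ｛ θ ｝) θ
  assumption h = hyp h (inj₂ refl)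

  axiom : IsHenkin φ → Axiom φ → Der S φ
  axiom h A = thm (ax (IsHenkin.henkin h) A)

  const-Der : IsHenkin θ → Der S φ → Der S (θ ⇒ φ)
  const-Der h d = let k = Der-Henkin d in app (axiom (Henkin-⇒ k (Henkin-⇒ h k)) A1-K) d

  app-under : Der S (θ ⇒ φ ⇒ ψ) → Der S (θ ⇒ φ) → Der S (θ ⇒ ψ)
  app-under d e =
    let h = Der-Henkin d
        k = Der-Henkin e
    in app (app (axiom (Henkin-⇒ h (Henkin-⇒ k (Henkin-⇒ (Henkin-⇒ˡ h) (Henkin-⇒ʳ (Henkin-⇒ʳ h))))) A1-S) d) e

  identity : IsHenkin θ → Der S (θ ⇒ θ)
  identity h = app-under (axiom (Henkin-⇒ h (Henkin-⇒ (Henkin-⇒ h h) h)) A1-K)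
                         (axiom (Henkin-⇒ h (Henkin-⇒ h h)) A1-K)

  deduction : IsHenkin θ → Der (S ∪ ｛ θ ｝) φ → Der S (θ ⇒ φ)
  deduction h (hyp k (inj₁ p))    = const-Der h (hyp k p)
  deduction h (hyp k (inj₂ refl)) = identity h
  deduction h (thm d)             = const-Der h (thm d)
  deduction h (app d e)           = app-under (deduction h d) (deduction h e)

  Henkin-∼ : IsHenkin φ → IsHenkin (∼ φ)
  Henkin-∼ h = Henkin-⇒ h Henkin-⊥

  DN-elim : Der S (∼ ∼ φ) → Der S φ
  DN-elim d =
    let h = Der-Henkin d in app (axiom (Henkin-⇒ h (Henkin-⇒ˡ (Henkin-⇒ˡ h))) A1-DN) d

  DN-intro : Der S φ → Der S (∼ ∼ φ)
  DN-intro d = let h = Henkin-∼ (Der-Henkin d) in deduction h (app (assumption h) (weaken d))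

  ex-falso : IsHenkin φ → Der S ⊥' → Der S φ
  ex-falso h d = DN-elim (const-Der (Henkin-∼ h) d)

  contraposition : Der S (φ ⇒ ψ) → Der S (∼ ψ) → Der S (∼ φ)
  contraposition d e = let h = Henkin-⇒ˡ (Der-Henkin d) in
    deduction h (app (weaken e) (app (weaken d) (assumption h)))

  ∨-introˡ : IsHenkin ψ → Der S φ → Der S (φ ∨' ψ)
  ∨-introˡ h d = let k = Henkin-∼ (Der-Henkin d) in
    deduction k (ex-falso h (app (assumption k) (weaken d)))

  ∨-introʳ : IsHenkin φ → Der S ψ → Der S (φ ∨' ψ)
  ∨-introʳ h d = const-Der (Henkin-∼ h) d

  ∨-mono : Der S (φ ⇒ ψ) → Der S (θ ⇒ χ) → Der S ((φ ∨' θ) ⇒ (ψ ∨' χ))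
  ∨-mono d e =
    let h = Der-Henkin d
        k = Der-Henkin e
        h∨ = Henkin-⇒ (Henkin-∼ (Henkin-⇒ˡ h)) (Henkin-⇒ˡ k)
        h∼ = Henkin-∼ (Henkin-⇒ʳ h)
    in deduction h∨ (deduction h∼ (app (weaken (weaken e))
         (app (weaken (assumption h∨)) (contraposition (weaken (weaken d)) (assumption h∼)))))

  ∼∨-intro : Der S (∼ φ) → Der S (∼ ψ) → Der S (∼ (φ ∨' ψ))
  ∼∨-intro d e =
    let h = Henkin-⇒ (Der-Henkin d) (Henkin-⇒ˡ (Der-Henkin e))
    in deduction h (app (weaken e) (app (assumption h) (weaken d)))

  ∼∨-elimˡ : Der S (∼ (φ ∨' ψ)) → Der S (∼ φ)
  ∼∨-elimˡ d =
    let h∨ = Henkin-⇒ˡ (Der-Henkin d)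
        h = Henkin-⇒ˡ (Henkin-⇒ˡ h∨)
    in deduction h (app (weaken d) (∨-introˡ (Henkin-⇒ʳ h∨) (assumption h)))

  ∼∨-elimʳ : Der S (∼ (φ ∨' ψ)) → Der S (∼ ψ)
  ∼∨-elimʳ d =
    let h∨ = Henkin-⇒ˡ (Der-Henkin d)
        h = Henkin-⇒ʳ h∨
    in deduction h (app (weaken d) (∨-introʳ (Henkin-⇒ˡ (Henkin-⇒ˡ h∨)) (assumption h)))

  ∧-intro : Der S φ → Der S ψ → Der S (φ ∧' ψ)
  ∧-intro d e =
    let h = Henkin-⇒ (Der-Henkin d) (Henkin-∼ (Der-Henkin e))
    in deduction h (app (app (assumption h) (weaken d)) (weaken e))

  ∧-elimˡ : Der S (φ ∧' ψ) → Der S φ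
  ∧-elimˡ d =
    let h = Henkin-⇒ˡ (Der-Henkin d)
        hφ = Henkin-⇒ˡ h
        h∼ = Henkin-∼ hφ
    in DN-elim (deduction h∼ (app (weaken d) (deduction hφ
         (ex-falso (Henkin-⇒ʳ h) (app (weaken (assumption h∼)) (assumption hφ))))))

  ∧-elimʳ : Der S (φ ∧' ψ) → Der S ψ
  ∧-elimʳ d =
    let h = Henkin-⇒ˡ (Der-Henkin d)
        h∼ = Henkin-⇒ʳ h
    in DN-elim (deduction h∼ (app (weaken d) (const-Der (Henkin-⇒ˡ h) (assumption h∼))))

  ⋀-intro : ∀ {γs} → All (Der S) γs → Der S (⋀ γs)
  ⋀-intro []       = identity Henkin-⊥
  ⋀-intro (d ∷ ds) = ∧-intro d (⋀-intro ds)

  ⋀-elim : ∀ {γs γ} → γ ∈ₗ γs → Der S (⋀ γs) → Der S γ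
  ⋀-elim (here refl) d = ∧-elimˡ d
  ⋀-elim (there p)   d = ⋀-elim p (∧-elimʳ d)

  Der-∅ : Der ∅ᵤ φ → CS ⊢ φ
  Der-∅ (thm d)   = d
  Der-∅ (app d e) = mp (Der-∅ d) (Der-∅ e)

  Henkin-⋀ : ∀ {γs} → All IsHenkin γs → IsHenkin (⋀ γs)
  Henkin-⋀ []       = Henkin-∼ Henkin-⊥
  Henkin-⋀ (h ∷ hs) = Henkin-∼ (Henkin-⇒ h (Henkin-∼ (Henkin-⋀ hs)))

  compact : Der S φ → ∃ λ γs → All S γs × All IsHenkin γs × Der (_∈ₗ γs) φ
  compact (hyp h p) = _ ∷ [] , p ∷ [] , h ∷ [] , hyp h (here refl)
  compact (thm d)   = [] , [] , [] , thm d
  compact (app d e) =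
    let γs , p , h , d′ = compact d
        δs , q , k , e′ = compact e
    in γs ++ δs , Allₚ.++⁺ p q , Allₚ.++⁺ h k , app (mono ∈-++⁺ˡ d′) (mono (∈-++⁺ʳ γs) e′)

  Consistent⇒¬Der : Consistent CS S → ¬ Der S ⊥'
  Consistent⇒¬Der con d =
    let γs , p , h , d′ = compact d
        h⋀ = Henkin-⋀ h
    in con γs p (Der-∅ (deduction h⋀ (bind (λ _ q → ⋀-elim q (assumption h⋀)) d′)))

  ¬Der⇒Consistent : (∀ {φ} → φ ∈ S → IsHenkin φ) → ¬ Der S ⊥' → Consistent CS S
  ¬Der⇒Consistent h con γs p d = con (app (thm d) (⋀-intro (All.map (λ q → hyp (h q) q) p)))

  -- Subscripts of justification formulas

  ∈-foldr-insert⁺ʳ : ∀ {X v} ys → v ∈ₛ X → v ∈ₛ foldr insert X ys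
  ∈-foldr-insert⁺ʳ [] p = p
  ∈-foldr-insert⁺ʳ (y ∷ ys) p = ∈-insert⁺ʳ (foldr insert _ ys) (∈-foldr-insert⁺ʳ ys p)

  ∈-foldr-insert⁺ˡ : ∀ {X v ys} → v ∈ₗ ys → v ∈ₛ foldr insert X ys
  ∈-foldr-insert⁺ˡ {ys = y ∷ ys} (here refl) = ∈-insert⁺ˡ (foldr insert _ ys)
  ∈-foldr-insert⁺ˡ {ys = y ∷ ys} (there p) = ∈-insert⁺ʳ (foldr insert _ ys) (∈-foldr-insert⁺ˡ p)

  ∈-foldr-insert⁻ : ∀ {X v} ys → v ∈ₛ foldr insert X ys → v ∈ₗ ys ⊎ v ∈ₛ X
  ∈-foldr-insert⁻ [] p = inj₂ p
  ∈-foldr-insert⁻ (y ∷ ys) p with ∈-insert⁻ (foldr insert _ ys) p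
  ... | inj₁ e = inj₁ (here e)
  ... | inj₂ q = [ inj₁ ∘ there , inj₂ ]′ (∈-foldr-insert⁻ ys q)

  foldr-insert-⊆ : ∀ {X} Y → (∀ {v} → v ∈ₛ X → v ∈ₛ Y) → foldr insert X (elems Y) ≡ Y
  foldr-insert-⊆ Y X⊆Y = VarSet-ext ([ id , X⊆Y ]′ ∘ ∈-foldr-insert⁻ (elems Y)) ∈-foldr-insert⁺ˡ

  extend : ∀ {X} Y → (∀ {v} → v ∈ₛ X → v ∈ₛ Y) → Der S (t ∶[ X ] φ) → Der S (t ∶[ Y ] φ)
  extend {S = S} {t = t} {φ = φ} {X} Y X⊆Y d =
    subst (λ Z → Der S (t ∶[ Z ] φ)) (foldr-insert-⊆ Y X⊆Y) (go (elems Y))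
    where
    go : ∀ ys → Der S (t ∶[ foldr insert X ys ] φ)
    go [] = d
    go (y ∷ ys) =
      let e = go ys
          h = Der-Henkin e
      in app (axiom (Henkin-⇒ h (Henkin-∶ (Henkin-∶⁻ h)
           (∈-insert⁺ʳ (foldr insert X ys) ∘ Henkin-subscript h))) A3) e

  -- The surplus variables are removed one at a time. If one is not free in `φ`, A2 removes it;
  -- otherwise it belongs to `X`, and inserting it changed nothing.
  shrink : ∀ X Y → (∀ {v} → v ∈ₛ X → v ∈ₛ Y) → (∀ {v} → v ∈ₛ Y → v ∈ₛ fv φ → v ∈ₛ X) →
           Der S (t ∶[ Y ] φ) → Der S (t ∶[ X ] φ)
  shrink {φ = φ} {S = S} {t = t} X Y X⊆Y Y∩fv⊆X d =
    go (elems Y) Y∩fv⊆X (subst (λ Z → Der S (t ∶[ Z ] φ)) (sym (foldr-insert-⊆ Y X⊆Y)) d)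
    where
    h = Der-Henkin d
    go : ∀ ys → (∀ {v} → v ∈ₗ ys → v ∈ₛ fv φ → v ∈ₛ X) →
         Der S (t ∶[ foldr insert X ys ] φ) → Der S (t ∶[ X ] φ)
    go [] _ e = e
    go (y ∷ ys) ys∩fv⊆X e with y ∈ₛ? fv φ
    ... | no n = go ys (ys∩fv⊆X ∘ there) (app (axiom (Henkin-⇒ (Der-Henkin e) (Henkin-∶ (Henkin-∶⁻ h)
            λ p → ∈-foldr-insert⁺ʳ ys (Y∩fv⊆X (Henkin-subscript h p) p))) (A2 n)) e)
    ... | yes p = go ys (ys∩fv⊆X ∘ there) (subst (λ Z → Der S (t ∶[ Z ] φ)) present e)
      where
      present : insert y (foldr insert X ys) ≡ foldr insert X ys
      present = VarSet-ext
        (λ q → case ∈-insert⁻ (foldr insert X ys) q of λ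
          { (inj₁ e) → subst (_∈ₛ foldr insert X ys) (sym e) (∈-foldr-insert⁺ʳ ys (ys∩fv⊆X (here refl) p))
          ; (inj₂ r) → r })
        (∈-insert⁺ʳ (foldr insert X ys))

  wits-∶ : ∀ t φ → wits (t ∶[ wits φ ] φ) ≡ wits φ
  wits-∶ t φ = wits-cong (t ∶[ wits φ ] φ) φ (∈-wits-wit φ) (∈-wits⁺ φ)

  wits-∀ : ∀ x φ → wits (∀' x φ) ≡ wits φ
  wits-∀ x φ = wits-cong (∀' x φ) φ (proj₁ ∘ ∈-delete⁻ (fv φ)) (λ p → ∈-delete⁺ (fv φ) p λ ())

  wits⊆⇒ˡ : ∀ φ ψ {v} → v ∈ₛ wits φ → v ∈ₛ wits (φ ⇒ ψ)
  wits⊆⇒ˡ φ ψ p with ∈-wits⁻ φ p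
  ... | q , a , refl = ∈-wits⁺ (φ ⇒ ψ) (∈-∪⁺ˡ (fv φ) (fv ψ) q)

  wits⊆⇒ʳ : ∀ φ ψ {v} → v ∈ₛ wits ψ → v ∈ₛ wits (φ ⇒ ψ)
  wits⊆⇒ʳ φ ψ p with ∈-wits⁻ ψ p
  ... | q , a , refl = ∈-wits⁺ (φ ⇒ ψ) (∈-∪⁺ʳ (fv φ) (fv ψ) q)

  -- B2 wants one common subscript. The minor premise is enlarged to the witnesses of the
  -- implication, and those absent from `ψ` are dropped from the conclusion.
  apply : Der S (t ∶[ wits (φ ⇒ ψ) ] (φ ⇒ ψ)) → Der S (s ∶[ wits φ ] φ) → Der S ((t · s) ∶[ wits ψ ] ψ)
  apply {φ = φ} {ψ = ψ} d e =
    let W = wits (φ ⇒ ψ)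
        e′ = extend W (wits⊆⇒ˡ φ ψ) e
        h = Der-Henkin d
        k = Henkin-∶ (Henkin-⇒ʳ (Henkin-∶⁻ h)) (wits⊆⇒ʳ φ ψ ∘ ∈-wits⁺ ψ)
    in shrink (wits ψ) W (wits⊆⇒ʳ φ ψ)
         (λ p q → let _ , a , e = ∈-wits⁻ (φ ⇒ ψ) p in
           subst (_∈ₛ wits ψ) (sym e) (∈-wits⁺ ψ (subst (_∈ₛ fv ψ) e q)))
         (app (app (axiom (Henkin-⇒ h (Henkin-⇒ (Der-Henkin e′) k)) B2) d) e′)

  -- The normalized subscript has no basic variables, so the side condition of B5 holds for every
  -- `x`.
  generalize : ∀ x → Der S (t ∶[ wits φ ] φ) → Der S (gen x t ∶[ wits (∀' x φ) ] ∀' x φ)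
  generalize {φ = φ} x d rewrite wits-∀ x φ =
    let h = Der-Henkin d
    in app (axiom (Henkin-⇒ h (Henkin-∶ (Henkin-∀ x (Henkin-∶⁻ h)) (∈-wits⁺ φ ∘ proj₁ ∘ ∈-delete⁻ (fv φ))))
             (B5 (basic∉wits φ))) d

  -- Universal closures

  ∀-elim : ∀ {x v} → FreeFor v x φ → Der S (∀' x φ) → Der S (φ [ x ≔ v ])
  ∀-elim {φ = φ} {x = x} {v} ff d =
    let h = Der-Henkin d
    in app (axiom (Henkin-⇒ h (Henkin-sub (single x v) φ (Henkin-∀⁻ h))) (A1-∀E ff)) d

  ∀*-elim : ∀ xs → Der S (∀* xs φ) → Der S φ
  ∀*-elim [] d = d
  ∀*-elim {S = S} {φ = φ} (x ∷ xs) d = ∀*-elim xs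
    (subst (Der S) (sub-id (∀* xs φ) λ {v} _ → single-self x v)
      (∀-elim (FreeFor-self x (∀* xs φ)) d))

  exceptAll : List ℕ → (Var → Var) → Var → Var
  exceptAll xs σ = foldl (λ σ x → except x σ) σ xs

  sub-∀* : ∀ xs σ φ → sub σ (∀* xs φ) ≡ ∀* xs (sub (exceptAll xs σ) φ)
  sub-∀* [] σ φ = refl
  sub-∀* (x ∷ xs) σ φ = cong (∀' x) (sub-∀* xs (except x σ) φ)

  exceptAll-cases : ∀ xs σ v → exceptAll xs σ v ≡ σ v ⊎ (exceptAll xs σ v ≡ v × ∃ λ x → v ≡ basic x × x ∈ₗ xs)
  exceptAll-cases [] σ v = inj₁ refl
  exceptAll-cases (x ∷ xs) σ v with exceptAll-cases xs (except x σ) v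
  ... | inj₂ (e , y , e′ , p) = inj₂ (e , y , e′ , there p)
  ... | inj₁ e with v ≟ basic x
  ... | yes e′ = inj₂ (e , x , e′ , here refl)
  ... | no _ = inj₁ e

  -- The quantifiers are instantiated one by one, and `ground v` absorbs each instantiation `τ`
  -- because it would send `basic x` to the same witness and fixes witnesses.
  ∀*-ground : ∀ v xs φ → (∀ {x} → basic x ∈ₛ fv φ → x ∈ₗ xs) →
              Der S (∀* xs φ) → Der S (sub (ground v) φ)
  ∀*-ground {S = S} v [] φ covers d = subst (Der S) (sym (sub-id φ fixed)) d
    where
    fixed : ∀ {w} → w ∈ₛ fv φ → ground v w ≡ w
    fixed {basic x} p = case covers p of λ ()
    fixed {wit a} _ = refl
  ∀*-ground {S = S} v (x ∷ xs) φ covers d =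
    subst (Der S) (trans (sub-∘ φ h groundish) (sub-cong φ λ {w} _ → absorb w))
      (∀*-ground v xs (sub τ φ) covers′ (subst (Der S) (sub-∀* xs (single x (wit (v x))) φ)
        (∀-elim (FreeFor-wit (v x) x (∀* xs φ) h∀) d)))
    where
    h∀ = Henkin-∀⁻ (Der-Henkin d)
    h = Der-Henkin (∀*-elim (x ∷ xs) d)
    τ = exceptAll xs (single x (wit (v x)))
    -- If `x` occurs again in `xs`, the outer quantifier is vacuous: `τ` leaves `x` alone, and the
    -- later occurrence still covers it.
    τ-cases : ∀ w → (τ w ≡ w × (w ≡ basic x → x ∈ₗ xs)) ⊎ (w ≡ basic x × τ w ≡ wit (v x))
    τ-cases w with exceptAll-cases xs (single x (wit (v x))) w
    ... | inj₂ (e , y , refl , p) = inj₁ (e , λ { refl → p })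
    ... | inj₁ e with w ≟ basic x
    ... | yes e′ = inj₂ (e′ , e)
    ... | no n = inj₁ (e , λ e′ → contradiction e′ n)
    groundish : ∀ w → τ w ≡ w ⊎ IsWit (τ w)
    groundish w = [ inj₁ ∘ proj₁ , (λ (_ , e) → inj₂ (_ , e)) ]′ (τ-cases w)
    absorb : ∀ w → ground v (τ w) ≡ ground v w
    absorb w with τ-cases w
    ... | inj₁ (e , _) = cong (ground v) e
    ... | inj₂ (refl , e) = cong (ground v) e
    covers′ : ∀ {y} → basic y ∈ₛ fv (sub τ φ) → y ∈ₗ xs
    covers′ p with fv-sub⁻ τ φ p
    ... | w , q , e with τ-cases w
    ... | inj₂ (_ , e′) = case trans e e′ of λ ()
    ... | inj₁ (e′ , f) with trans e e′
    ... | refl with covers q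
    ... | here refl = f refl
    ... | there r = r

  ∈-freeBasics : ∀ φ {x} → basic x ∈ₛ fv φ → x ∈ₗ freeBasics φ
  ∈-freeBasics φ p = ∈-mapMaybe⁺ basicIndex p refl

-- Instantiation sets

⟦⟧-inhabited : ∀ {n} (F : Modal n) φs → ∃ λ ψ → ψ ∈ ⟦ F ⟧ φs
⟦⟧-inhabited (letter i) φs = lookup φs i , refl
⟦⟧-inhabited (neg F) φs = let ψ , p = ⟦⟧-inhabited F φs in _ , ψ , p , refl
⟦⟧-inhabited (conj F G) φs =
  let ψ , p = ⟦⟧-inhabited F φs ; θ , q = ⟦⟧-inhabited G φs in _ , ψ , θ , p , q , refl
⟦⟧-inhabited (disj F G) φs =
  let ψ , p = ⟦⟧-inhabited F φs ; θ , q = ⟦⟧-inhabited G φs in _ , ψ , θ , p , q , refl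
⟦⟧-inhabited (□ F) φs = let ψ , p = ⟦⟧-inhabited F φs in _ , jvar 0 , ψ , p , refl

⟦⟧-Henkin : ∀ {n} (F : Modal n) {φs χ} → VecAll.All IsHenkin φs → χ ∈ ⟦ F ⟧ φs → IsHenkin χ
⟦⟧-Henkin (letter i) hs refl = VecAllₚ.lookup⁺ hs i
⟦⟧-Henkin (neg F) hs (ψ , p , refl) = Henkin-⇒ (⟦⟧-Henkin F hs p) Henkin-⊥
⟦⟧-Henkin (conj F G) hs (ψ , θ , p , q , refl) =
  Henkin-⇒ (Henkin-⇒ (⟦⟧-Henkin F hs p) (Henkin-⇒ (⟦⟧-Henkin G hs q) Henkin-⊥)) Henkin-⊥
⟦⟧-Henkin (disj F G) hs (ψ , θ , p , q , refl) =
  Henkin-⇒ (Henkin-⇒ (⟦⟧-Henkin F hs p) Henkin-⊥) (⟦⟧-Henkin G hs q)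
⟦⟧-Henkin (□ F) hs (t , ψ , p , refl) = Henkin-wits (⟦⟧-Henkin F hs p)

-- Internalization and directed instantiation sets

module Lifting (em : ExcludedMiddle 0ℓ) (CS : ConstSpec) (appropriate : AxiomaticallyAppropriate CS) where

  open Derivability CS

  -- Each rule has its term operation: constants for axioms, `!` through B4 for members of the
  -- specification, application for modus ponens, `gen` for generalization.
  lifting : ∀ {S φ} → CS ⊢ φ → ∃ λ t → Der S (t ∶[ wits φ ] φ)
  lifting (ax h A) = let c , s = lift-axiom em CS appropriate (hk h) A in const c , thm (cs s)
  lifting {S} (cs s@(witnessed {c} {φ} σ _ _)) =
    let ψ = sub (replace σ) φ
        h = ⊢-Henkin (cs s)
    in ! const c , subst (λ X → Der S ((! const c) ∶[ X ] const c ∶[ wits ψ ] ψ)) (sym (wits-∶ (const c) ψ))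
         (app (axiom (Henkin-⇒ h (Henkin-∶ h id)) B4) (thm (cs s)))
  lifting (mp d e) =
    let t , d′ = lifting d
        s , e′ = lifting e
    in t · s , apply d′ e′
  lifting (gen x d) = let t , d′ = lifting d in gen x t , generalize x d′

  lift-⇒ : ∀ {S φ ψ t} → CS ⊢ φ ⇒ ψ → ∃ λ s → Der S (t ∶[ wits φ ] φ ⇒ s ∶[ wits ψ ] ψ)
  lift-⇒ {t = t} d =
    let s , d′ = lifting d
        h = Henkin-wits (Henkin-⇒ˡ (⊢-Henkin d))
    in s · t , deduction h (apply d′ (assumption h))

  -- Sums of terms make the instantiation set of a disjunctive template directed.
  directed : ∀ {n} {F : Modal n} {φs ψ θ} → Disjunctive F → VecAll.All IsHenkin φs →
             ψ ∈ ⟦ F ⟧ φs → θ ∈ ⟦ F ⟧ φs →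
             ∃ λ χ → χ ∈ ⟦ F ⟧ φs × (CS ⊢ ψ ⇒ χ) × (CS ⊢ θ ⇒ χ)
  directed (letter i) hs refl refl =
    let d = Der-∅ (identity (VecAllₚ.lookup⁺ hs i)) in _ , refl , d , d
  directed (disj F G) hs (ψ₁ , θ₁ , p₁ , q₁ , refl) (ψ₂ , θ₂ , p₂ , q₂ , refl) =
    let ψ , p , d₁ , d₂ = directed F hs p₁ p₂
        θ , q , e₁ , e₂ = directed G hs q₁ q₂
    in _ , (ψ , θ , p , q , refl) ,
       Der-∅ (∨-mono (thm d₁) (thm e₁)) , Der-∅ (∨-mono (thm d₂) (thm e₂))
  directed {F = □ F₀} (□ F) hs (t₁ , ψ₁ , p₁ , refl) (t₂ , ψ₂ , p₂ , refl) =
    let ψ , p , d₁ , d₂ = directed F hs p₁ p₂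
        s₁ , e₁ = lift-⇒ d₁
        s₂ , e₂ = lift-⇒ d₂
        h = ⟦⟧-Henkin F₀ hs p
    in _ , (s₁ ⊹ s₂ , ψ , p , refl) ,
       Der-∅ (compose e₁ (axiom (Henkin-⇒ (Henkin-wits h) (Henkin-wits h)) B3ˡ)) ,
       Der-∅ (compose e₂ (axiom (Henkin-⇒ (Henkin-wits h) (Henkin-wits h)) B3ʳ))
    where
    compose : ∀ {S φ ψ χ} → Der S (φ ⇒ ψ) → Der S (ψ ⇒ χ) → Der S (φ ⇒ χ)
    compose d e = app-under (const-Der (Henkin-⇒ˡ (Der-Henkin d)) e) d

  -- A derivation may use several hypotheses `∼ ψ`. A common upper bound of the formulas `ψ` has a
  -- negation that implies them all, so a single member can be discharged.
  ⟦neg⟧-discharge : ∀ {n} {F : Modal n} {φs S χ} → Disjunctive F → VecAll.All IsHenkin φs →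
                    Der (S ∪ ⟦ neg F ⟧ φs) χ → ∃ λ ψ → ψ ∈ ⟦ F ⟧ φs × Der S (∼ ψ ⇒ χ)
  ⟦neg⟧-discharge {F = F} {φs} D hs (hyp h (inj₁ p)) =
    let ψ , q = ⟦⟧-inhabited F φs
    in ψ , q , const-Der (Henkin-∼ (⟦⟧-Henkin F hs q)) (hyp h p)
  ⟦neg⟧-discharge {F = F} D hs (hyp h (inj₂ (ψ , q , refl))) = ψ , q , identity h
  ⟦neg⟧-discharge {F = F} {φs} D hs (thm d) =
    let ψ , q = ⟦⟧-inhabited F φs
    in ψ , q , const-Der (Henkin-∼ (⟦⟧-Henkin F hs q)) (thm d)
  ⟦neg⟧-discharge {F = F} D hs (app d e) =
    let ψ , p , d′ = ⟦neg⟧-discharge D hs d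
        θ , q , e′ = ⟦neg⟧-discharge D hs e
        χ , r , ψ⇒χ , θ⇒χ = directed D hs p q
        h = Henkin-∼ (⟦⟧-Henkin F hs r)
    in χ , r , deduction h (app (app (weaken d′) (contraposition (thm ψ⇒χ) (assumption h)))
                                (app (weaken e′) (contraposition (thm θ⇒χ) (assumption h))))

  inconsistent⇒Der : ∀ {n} {F : Modal n} {φs S} → Disjunctive F → VecAll.All IsHenkin φs →
                     Der (S ∪ ⟦ neg F ⟧ φs) ⊥' → ∃ λ ψ → ψ ∈ ⟦ F ⟧ φs × Der S ψ
  inconsistent⇒Der D hs d = let ψ , p , d′ = ⟦neg⟧-discharge D hs d in ψ , p , DN-elim d′

  -- Closure properties of a world and of its set `Γ ♯`

  module World (Γ : 𝓦 CS) where

    open MaximallyConsistent (mcs Γ)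

    Γ-Henkin : ∀ {φ} → φ ∈ set Γ → IsHenkin φ
    Γ-Henkin p = hk (henkin p)

    ¬Der-⊥ : ¬ Der (set Γ) ⊥'
    ¬Der-⊥ = Consistent⇒¬Der consistent

    ∈⇒Der : ∀ {φ} → φ ∈ set Γ → Der (set Γ) φ
    ∈⇒Der p = hyp (Γ-Henkin p) p

    Der⇒∈ : ∀ {φ} → Der (set Γ) φ → φ ∈ set Γ
    Der⇒∈ d = maximal (IsHenkin.henkin (Der-Henkin d)) (¬Der⇒Consistent
      [ Γ-Henkin , (λ { refl → Der-Henkin d }) ]′
      (¬Der-⊥ ∘ bind λ { h (inj₁ p) → hyp h p ; h (inj₂ refl) → d }))

    ∉⇒∼∈ : ∀ {φ} → IsHenkin φ → ¬ (φ ∈ set Γ) → (∼ φ) ∈ set Γ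
    ∉⇒∼∈ h n = maximal (IsHenkin.henkin (Henkin-∼ h)) (¬Der⇒Consistent
      [ Γ-Henkin , (λ { refl → Henkin-∼ h }) ]′
      (λ d → n (Der⇒∈ (DN-elim (deduction (Henkin-∼ h) d)))))

    ♯-Henkin : ∀ {φ} → φ ∈ (set Γ ♯) → IsHenkin φ
    ♯-Henkin (t , φ , p , refl) = closure (freeBasics φ)
      where
      closure : ∀ xs → IsHenkin (∀* xs φ)
      closure [] = Henkin-∶⁻ (Γ-Henkin p)
      closure (x ∷ xs) = Henkin-∀ x (closure xs)

    -- A hypothesis from `Γ ♯` is the closure of a formula justified in Γ, and each quantifier of
    -- the closure costs one `gen`. The remaining rules are internalized as for theorems.
    ♯-lift : ∀ {ψ} → Der (set Γ ♯) ψ → ∃ λ t → (t ∶[ wits ψ ] ψ) ∈ set Γ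
    ♯-lift d = let t , d′ = go d in t , Der⇒∈ d′
      where
      go : ∀ {ψ} → Der (set Γ ♯) ψ → ∃ λ t → Der (set Γ) (t ∶[ wits ψ ] ψ)
      go (hyp _ (t , φ , p , refl)) = closure (freeBasics φ)
        where
        closure : ∀ xs → ∃ λ t → Der (set Γ) (t ∶[ wits (∀* xs φ) ] ∀* xs φ)
        closure [] = t , ∈⇒Der p
        closure (x ∷ xs) = let s , d = closure xs in gen x s , generalize x d
      go (thm d) = lifting d
      go (app d e) =
        let t , d′ = go d
            s , e′ = go e
        in t · s , apply d′ e′

    -- The problem is moved from `Γ ♯` to Γ by prefixing `□`. On the way back, a refutation for the
    -- chosen witness would prove some instance `ψ` from `Γ ♯`; its lift `t ∶[ wits ψ ] ψ` lies in Γ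
    -- and contradicts the instances of `neg (□ F)`.
    ♯-witness : ∀ {n} {F : Modal (suc n)} {φs x χ} → DisjunctiveTemplate F →
                VecAll.All IsHenkin φs → IsHenkin (∀' x χ) →
                ¬ Der ((set Γ ♯) ∪ ⟦ neg F ⟧ (∀' x χ ∷ φs)) ⊥' →
                ∃ λ a → ¬ Der ((set Γ ♯) ∪ ⟦ neg F ⟧ (χ [ x ≔ wit a ] ∷ φs)) ⊥'
    ♯-witness {F = F} {φs} {x} {χ} D hs h con =
      let a , con′ = admit Γ (□ F) record { disjunctive = □ disjunctive ; atMostOnce = atMostOnce }
                       φs (VecAll.map IsHenkin.henkin hs) x χ (IsHenkin.henkin h)
                       (¬Der⇒Consistent [ Γ-Henkin , ⟦⟧-Henkin (neg (□ F)) (h ∷ hs) ]′ □-consistent)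
      in a , λ d →
        let ψ , p , d′ = inconsistent⇒Der disjunctive
                           (Henkin-sub (single x (wit a)) χ (Henkin-∀⁻ h) ∷ hs) d
            t , q = ♯-lift d′
            d″ = mono inj₁ (∈⇒Der q)
        in Consistent⇒¬Der con′
             (app (hyp (Henkin-∼ (Γ-Henkin q)) (inj₂ (_ , (t , ψ , p , refl) , refl))) d″)
      where
      open DisjunctiveTemplate D
      □-consistent : ¬ Der (set Γ ∪ ⟦ neg (□ F) ⟧ (∀' x χ ∷ φs)) ⊥'
      □-consistent d = ¬Der-⊥ (bind (λ { k (inj₁ p) → hyp k p
                                       ; k (inj₂ (_ , (t , ψ , p , refl) , refl)) → ∼□∈Γ k p }) d)
        where
        ∼□∈Γ : ∀ {t ψ} → IsHenkin (∼ (t ∶[ wits ψ ] ψ)) → ψ ∈ ⟦ F ⟧ (∀' x χ ∷ φs) →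
               Der (set Γ) (∼ (t ∶[ wits ψ ] ψ))
        -- If Γ contained the justification, the closure of `ψ` would be in `Γ ♯` and refute the
        -- hypothesis `∼ ψ`.
        ∼□∈Γ {t} {ψ} k p = ∈⇒Der (∉⇒∼∈ (Henkin-⇒ˡ k) λ q →
          let ∀ψ = t , ψ , q , refl in
          con (app (hyp (Henkin-∼ (⟦⟧-Henkin F (h ∷ hs) p)) (inj₂ (ψ , p , refl)))
                   (∀*-elim (freeBasics ψ) (hyp (♯-Henkin ∀ψ) (inj₁ ∀ψ)))))

-- Enumeration of instantiation problems

-- Cantor's walk along the antidiagonals, each entered at first coordinate zero.
advance : ℕ × ℕ → ℕ × ℕ
advance (x , zero)  = zero , suc x
advance (x , suc y) = suc x , y

unpair : ℕ → ℕ × ℕ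
unpair zero    = zero , zero
unpair (suc n) = advance (unpair n)

unpair-surjective : ∀ x y → ∃ λ n → unpair n ≡ (x , y)
unpair-surjective x y = go (x + y) x y refl
  where
  go : ∀ s x y → x + y ≡ s → ∃ λ n → unpair n ≡ (x , y)
  go s zero zero e = zero , refl
  go (suc s) zero (suc y) e =
    let n , p = go s y zero (trans (ℕₚ.+-identityʳ y) (ℕₚ.suc-injective e)) in suc n , cong advance p
  go s (suc x) y e = let n , p = go s x (suc y) (trans (ℕₚ.+-suc x y) e) in suc n , cong advance p

infixr 5 _∙_

-- A universal syntax of binary trees. The decoders below are total, with arbitrary tags and default
-- values, since only their surjectivity matters.
data Code : Set where
  leaf : ℕ → Code
  _∙_  : Code → Code → Code

-- The first argument bounds the recursion.
code : ℕ → ℕ → Code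
code zero    n = leaf n
code (suc k) n with unpair n
-- A zero in the first component marks a leaf; the left subtree of a node is stored shifted by one.
... | zero  , m = leaf m
... | suc i , j = code k i ∙ code k j

height : Code → ℕ
height (leaf _) = 0
height (c ∙ d)  = suc (height c ⊔ height d)

code-surjective : ∀ k c → height c ≤ k → ∃ λ n → code k n ≡ c
code-surjective zero (leaf m) _ = m , refl
code-surjective (suc k) (leaf m) _ with unpair-surjective zero m
... | n , e = n , eq
  where
  eq : code (suc k) n ≡ leaf m
  eq rewrite e = refl
code-surjective (suc k) (c ∙ d) (s≤s le)
  with code-surjective k c (ℕₚ.m⊔n≤o⇒m≤o _ (height d) le) | code-surjective k d (ℕₚ.m⊔n≤o⇒n≤o (height c) _ le)
... | i , p | j , q with unpair-surjective (suc i) j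
... | n , e = n , eq
  where
  eq : code (suc k) n ≡ c ∙ d
  eq rewrite e = cong₂ _∙_ p q

Onto : {A : Set} → (Code → A) → A → Set
Onto f a = ∃ λ c → f c ≡ a

toVar : Code → Var
toVar (leaf n ∙ _) = basic n
toVar (leaf n)     = wit n
toVar _            = wit 0

toVar-onto : ∀ v → Onto toVar v
toVar-onto (basic x) = leaf x ∙ leaf 0 , refl
toVar-onto (wit a)   = leaf a , refl

toVars : Code → List Var
toVars (leaf _) = []
toVars (c ∙ d)  = toVar c ∷ toVars d

toVars-onto : ∀ vs → Onto toVars vs
toVars-onto [] = leaf 0 , refl
toVars-onto (v ∷ vs) =
  let c , p = toVar-onto v ; d , q = toVars-onto vs in c ∙ d , cong₂ _∷_ p q

toVarSet : Code → VarSet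
toVarSet = fromList ∘ toVars

toVarSet-onto : ∀ X → Onto toVarSet X
toVarSet-onto X = let c , p = toVars-onto (elems X) in
  c , trans (cong fromList p) (VarSet-ext (∈-fromList⁻ (elems X)) ∈-fromList⁺)

toVec : {A : Set} → (Code → A) → ∀ n → Code → Vec A n
toVec f zero    _        = []
toVec f (suc n) (c ∙ d)  = f c ∷ toVec f n d
toVec f (suc n) (leaf i) = f (leaf i) ∷ toVec f n (leaf i)

toVec-onto : ∀ {A : Set} {f : Code → A} → (∀ a → Onto f a) → ∀ {n} (as : Vec A n) → Onto (toVec f n) as
toVec-onto onto [] = leaf 0 , refl
toVec-onto onto (a ∷ as) =
  let c , p = onto a ; d , q = toVec-onto onto as in c ∙ d , cong₂ _∷_ p q

toTerm : Code → Term
toTerm (leaf 0 ∙ leaf i)     = jvar i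
toTerm (leaf 1 ∙ leaf c)     = const c
toTerm (leaf 2 ∙ c ∙ d)      = toTerm c · toTerm d
toTerm (leaf 3 ∙ c ∙ d)      = toTerm c ⊹ toTerm d
toTerm (leaf 4 ∙ c)          = ! toTerm c
toTerm (leaf 5 ∙ c)          = b (toTerm c)
toTerm (leaf 6 ∙ leaf x ∙ c) = gen x (toTerm c)
toTerm _                     = jvar 0

toTerm-onto : ∀ t → Onto toTerm t
toTerm-onto (jvar i)  = leaf 0 ∙ leaf i , refl
toTerm-onto (const c) = leaf 1 ∙ leaf c , refl
toTerm-onto (t · s)   =
  let c , p = toTerm-onto t ; d , q = toTerm-onto s in leaf 2 ∙ c ∙ d , cong₂ _·_ p q
toTerm-onto (t ⊹ s)   =
  let c , p = toTerm-onto t ; d , q = toTerm-onto s in leaf 3 ∙ c ∙ d , cong₂ _⊹_ p q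
toTerm-onto (! t)     = let c , p = toTerm-onto t in leaf 4 ∙ c , cong !_ p
toTerm-onto (b t)     = let c , p = toTerm-onto t in leaf 5 ∙ c , cong b p
toTerm-onto (gen x t) = let c , p = toTerm-onto t in leaf 6 ∙ leaf x ∙ c , cong (gen x) p

toFml : Code → Fml
toFml (leaf 0 ∙ leaf n ∙ leaf P ∙ c) = atom P (toVec toVar n c)
toFml (leaf 1 ∙ c ∙ d)               = toFml c ⇒ toFml d
toFml (leaf 2 ∙ leaf x ∙ c)          = ∀' x (toFml c)
toFml (leaf 3 ∙ c ∙ d ∙ e)           = toTerm c ∶[ toVarSet d ] toFml e
toFml _                              = ⊥'

toFml-onto : ∀ φ → Onto toFml φ
toFml-onto (atom {n} P vs) =
  let c , p = toVec-onto toVar-onto vs in leaf 0 ∙ leaf n ∙ leaf P ∙ c , cong (atom P) p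
toFml-onto ⊥'              = leaf 0 , refl
toFml-onto (φ ⇒ ψ)         =
  let c , p = toFml-onto φ ; d , q = toFml-onto ψ in leaf 1 ∙ c ∙ d , cong₂ _⇒_ p q
toFml-onto (∀' x φ)        = let c , p = toFml-onto φ in leaf 2 ∙ leaf x ∙ c , cong (∀' x) p
toFml-onto (t ∶[ X ] φ)    =
  let c , p = toTerm-onto t ; d , q = toVarSet-onto X ; e , r = toFml-onto φ
  in leaf 3 ∙ c ∙ d ∙ e , trans (cong₂ (λ t X → t ∶[ X ] _) p q) (cong (t ∶[ X ]_) r)

toFin : ∀ n → ℕ → Fin (suc n)
toFin n       zero    = zero
toFin zero    (suc i) = zero
toFin (suc n) (suc i) = suc (toFin n i)

toFin-onto : ∀ {n} (i : Fin (suc n)) → ∃ λ k → toFin n k ≡ i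
toFin-onto zero = zero , refl
toFin-onto {suc n} (suc i) = let k , p = toFin-onto i in suc k , cong suc p

-- The left child selects the connective: `leaf zero` for `□`, a node for `disj`.
toModal : ∀ n → Code → Modal (suc n)
toModal n (leaf i)           = letter (toFin n i)
toModal n (leaf zero ∙ c)    = □ (toModal n c)
toModal n (leaf (suc _) ∙ _) = letter zero
toModal n ((c ∙ _) ∙ d)      = disj (toModal n c) (toModal n d)

toModal-onto : ∀ {n} {F : Modal (suc n)} → Disjunctive F → Onto (toModal n) F
toModal-onto (letter i) = let k , p = toFin-onto i in leaf k , cong letter p
toModal-onto (disj F G) =
  let c , p = toModal-onto F ; d , q = toModal-onto G in (c ∙ leaf 0) ∙ d , cong₂ disj p q
toModal-onto (□ F)      = let c , p = toModal-onto F in leaf 0 ∙ c , cong □ p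

record Problem : Set where
  constructor problem
  field
    {size}   : ℕ
    template : Modal (suc size)
    fmls     : Vec Fml size
    var      : ℕ
    body     : Fml

toProblem : Code → Problem
toProblem (leaf n ∙ c ∙ d ∙ leaf x ∙ e) = problem (toModal n c) (toVec toFml n d) x (toFml e)
toProblem _                             = problem (letter zero) [] 0 ⊥'

-- The recursion bound of `code` is part of the index, so that one sequence reaches trees of every
-- height.
problemAt : ℕ → Problem
problemAt n = let k , m = unpair n in toProblem (code k m)

problemAt-onto : ∀ {n} {F : Modal (suc n)} → Disjunctive F → ∀ φs x χ →
                 ∃ λ k → problemAt k ≡ problem F φs x χ
problemAt-onto {n} {F} D φs x χ =
  let c , p = toModal-onto D
      d , q = toVec-onto toFml-onto φs
      e , r = toFml-onto χ
      w = leaf n ∙ c ∙ d ∙ leaf x ∙ e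
      m , s = code-surjective (height w) w ℕₚ.≤-refl
      k , u = unpair-surjective (height w) m
  in k , trans (cong (λ (i , j) → toProblem (code i j)) u) (trans (cong toProblem s)
       (trans (cong₂ (λ F φs → problem F φs x (toFml e)) p q) (cong (problem F φs x) r)))

-- Disjunction of templates with disjoint letters

reletter : ∀ {m n} → (Fin m → Fin n) → Modal m → Modal n
reletter f (letter i) = letter (f i)
reletter f (neg F)    = neg (reletter f F)
reletter f (conj F G) = conj (reletter f F) (reletter f G)
reletter f (disj F G) = disj (reletter f F) (reletter f G)
reletter f (□ F)      = □ (reletter f F)

letters-reletter : ∀ {m n} (f : Fin m → Fin n) F → letters (reletter f F) ≡ map f (letters F)
letters-reletter f (letter i) = refl
letters-reletter f (neg F)    = letters-reletter f F
letters-reletter f (conj F G) = trans (cong₂ _++_ (letters-reletter f F) (letters-reletter f G))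
                                      (sym (map-++ f (letters F) (letters G)))
letters-reletter f (disj F G) = trans (cong₂ _++_ (letters-reletter f F) (letters-reletter f G))
                                      (sym (map-++ f (letters F) (letters G)))
letters-reletter f (□ F)      = letters-reletter f F

Disjunctive-reletter : ∀ {m n} (f : Fin m → Fin n) {F} → Disjunctive F → Disjunctive (reletter f F)
Disjunctive-reletter f (letter i) = letter (f i)
Disjunctive-reletter f (disj F G) = disj (Disjunctive-reletter f F) (Disjunctive-reletter f G)
Disjunctive-reletter f (□ F)      = □ (Disjunctive-reletter f F)

module _ {m n : ℕ} {f : Fin m → Fin n} {φs : Vec Fml n} {ψs : Vec Fml m}
         (same : ∀ i → lookup φs (f i) ≡ lookup ψs i) where

  ⟦reletter⟧⁻ : ∀ F {χ} → χ ∈ ⟦ reletter f F ⟧ φs → χ ∈ ⟦ F ⟧ ψs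
  ⟦reletter⟧⁻ (letter i) p = trans p (same i)
  ⟦reletter⟧⁻ (neg F) (ψ , p , e) = ψ , ⟦reletter⟧⁻ F p , e
  ⟦reletter⟧⁻ (conj F G) (ψ , θ , p , q , e) = ψ , θ , ⟦reletter⟧⁻ F p , ⟦reletter⟧⁻ G q , e
  ⟦reletter⟧⁻ (disj F G) (ψ , θ , p , q , e) = ψ , θ , ⟦reletter⟧⁻ F p , ⟦reletter⟧⁻ G q , e
  ⟦reletter⟧⁻ (□ F) (t , ψ , p , e) = t , ψ , ⟦reletter⟧⁻ F p , e

  ⟦reletter⟧⁺ : ∀ F {χ} → χ ∈ ⟦ F ⟧ ψs → χ ∈ ⟦ reletter f F ⟧ φs
  ⟦reletter⟧⁺ (letter i) p = trans p (sym (same i))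
  ⟦reletter⟧⁺ (neg F) (ψ , p , e) = ψ , ⟦reletter⟧⁺ F p , e
  ⟦reletter⟧⁺ (conj F G) (ψ , θ , p , q , e) = ψ , θ , ⟦reletter⟧⁺ F p , ⟦reletter⟧⁺ G q , e
  ⟦reletter⟧⁺ (disj F G) (ψ , θ , p , q , e) = ψ , θ , ⟦reletter⟧⁺ F p , ⟦reletter⟧⁺ G q , e
  ⟦reletter⟧⁺ (□ F) (t , ψ , p , e) = t , ψ , ⟦reletter⟧⁺ F p , e

module Join {m n : ℕ} (G : Modal n) (F : Modal (suc m)) where

  -- The letter 𝐪 of the new problem must keep index zero, so the letters of `G` are placed behind
  -- the parameters of `F`. The letters for earlier witness instances thus become ordinary
  -- parameters.
  left : Fin n → Fin (suc (m + n))
  left i = suc (m ↑ʳ i)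

  right : Fin (suc m) → Fin (suc (m + n))
  right zero    = zero
  right (suc i) = suc (i ↑ˡ n)

  join : Modal (suc (m + n))
  join = disj (reletter left G) (reletter right F)

  left-injective : ∀ {i j} → left i ≡ left j → i ≡ j
  left-injective e = Finₚ.↑ʳ-injective m _ _ (Finₚ.suc-injective e)

  right-injective : ∀ {i j} → right i ≡ right j → i ≡ j
  right-injective {zero} {zero} e = refl
  right-injective {suc i} {suc j} e = cong suc (Finₚ.↑ˡ-injective n i j (Finₚ.suc-injective e))

  left≢right : ∀ i j → left i ≢ right j
  left≢right i (suc j) e = case trans (sym (Finₚ.splitAt-↑ʳ m n i))
    (trans (cong (splitAt m) (Finₚ.suc-injective e)) (Finₚ.splitAt-↑ˡ m j n)) of λ ()

  join-template : DisjunctiveTemplate G → DisjunctiveTemplate F → DisjunctiveTemplate join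
  join-template D E = record
    { disjunctive = disj (Disjunctive-reletter left D.disjunctive) (Disjunctive-reletter right E.disjunctive)
    ; atMostOnce  = subst Unique (sym (cong₂ _++_ (letters-reletter left G) (letters-reletter right F)))
        (Uniqueₚ.++⁺ (Uniqueₚ.map⁺ left-injective D.atMostOnce) (Uniqueₚ.map⁺ right-injective E.atMostOnce)
          λ (p , q) → let i , _ , e = ∈-map⁻ left p ; j , _ , e′ = ∈-map⁻ right q in
            left≢right i j (trans (sym e) e′))
    }
    where
    module D = DisjunctiveTemplate D
    module E = DisjunctiveTemplate E

  module _ (q : Fml) (φs : Vec Fml m) (ψs : Vec Fml n) where

    joined : Vec Fml (suc (m + n))
    joined = q ∷ φs Vec.++ ψs

    same-right : ∀ i → lookup joined (right i) ≡ lookup (q ∷ φs) i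
    same-right zero    = refl
    same-right (suc i) = Vecₚ.lookup-++ˡ φs ψs i

    ⟦neg-join⟧⁻ : ∀ {χ} → χ ∈ ⟦ neg join ⟧ joined →
                  ∃ λ ψ → ∃ λ θ → ψ ∈ ⟦ G ⟧ ψs × θ ∈ ⟦ F ⟧ (q ∷ φs) × χ ≡ ∼ (ψ ∨' θ)
    ⟦neg-join⟧⁻ (_ , (ψ , θ , p , r , refl) , e) =
      ψ , θ , ⟦reletter⟧⁻ (Vecₚ.lookup-++ʳ φs ψs) G p , ⟦reletter⟧⁻ same-right F r , e

    ⟦neg-join⟧⁺ : ∀ {ψ θ} → ψ ∈ ⟦ G ⟧ ψs → θ ∈ ⟦ F ⟧ (q ∷ φs) → ∼ (ψ ∨' θ) ∈ ⟦ neg join ⟧ joined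
    ⟦neg-join⟧⁺ p r = _ , (_ , _ , ⟦reletter⟧⁺ (Vecₚ.lookup-++ʳ φs ψs) G p , ⟦reletter⟧⁺ same-right F r , refl) , refl

-- Extension to a world

module Extension (em : ExcludedMiddle 0ℓ) (CS : ConstSpec) (appropriate : AxiomaticallyAppropriate CS)
                 (Γ : 𝓦 CS) where

  open Derivability CS
  open Lifting em CS appropriate
  open World Γ
  open Problem

  -- The formulas added to Γ ♯ so far form the instantiation set of the negation
  -- of a single disjunctive template.
  record Stage : Set where
    field
      {letterCount} : ℕ
      modal         : Modal letterCount
      isTemplate    : DisjunctiveTemplate modal
      values        : Vec Fml letterCount
      areHenkin     : VecAll.All IsHenkin values

    hyps : Pred Fml 0ℓ
    hyps = (set Γ ♯) ∪ ⟦ neg modal ⟧ values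

    field
      consistent : ¬ Der hyps ⊥'

    hyps-Henkin : ∀ {φ} → φ ∈ hyps → IsHenkin φ
    hyps-Henkin = [ ♯-Henkin , ⟦⟧-Henkin (neg modal) areHenkin ]′

  open Stage

  extended : Stage → (p : Problem) → Fml → Pred Fml 0ℓ
  extended s p q = (set Γ ♯) ∪ ⟦ neg join ⟧ (joined q (fmls p) (values s))
    where open Join (modal s) (template p)

  record Admissible (s : Stage) (p : Problem) : Set where
    constructor admissible
    field
      isTemplate  : DisjunctiveTemplate (template p)
      fmls-Henkin : VecAll.All IsHenkin (fmls p)
      body-Henkin : IsHenkin (∀' (var p) (body p))
      consistent  : ¬ Der (extended s p (∀' (var p) (body p))) ⊥'

  module _ (s : Stage) (p : Problem) (A : Admissible s p) where

    private
      module A = Admissible A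
      module J = Join (modal s) (template p)

    witness : ∃ λ a → ¬ Der (extended s p (body p [ var p ≔ wit a ])) ⊥'
    witness = ♯-witness (J.join-template (isTemplate s) A.isTemplate)
      (VecAllₚ.++⁺ A.fmls-Henkin (areHenkin s)) A.body-Henkin A.consistent

    instantiate : Stage
    instantiate = record
      { modal      = J.join
      ; isTemplate = J.join-template (isTemplate s) A.isTemplate
      ; values     = J.joined (body p [ var p ≔ wit (proj₁ witness) ]) (fmls p) (values s)
      ; areHenkin  = Henkin-sub _ (body p) (Henkin-∀⁻ A.body-Henkin) ∷ VecAllₚ.++⁺ A.fmls-Henkin (areHenkin s)
      ; consistent = proj₂ witness
      }

    ∼∨-hyp : ∀ {ψ θ} → ψ ∈ ⟦ modal s ⟧ (values s) →
             θ ∈ ⟦ template p ⟧ (body p [ var p ≔ wit (proj₁ witness) ] ∷ fmls p) →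
             Der (hyps instantiate) (∼ (ψ ∨' θ))
    ∼∨-hyp q r = let m = J.⟦neg-join⟧⁺ _ (fmls p) (values s) q r in
      hyp (hyps-Henkin instantiate (inj₂ m)) (inj₂ m)

    instantiate-⊇ : ∀ {φ} → φ ∈ hyps s → Der (hyps instantiate) φ
    instantiate-⊇ (inj₁ q) = hyp (♯-Henkin q) (inj₁ q)
    instantiate-⊇ (inj₂ (ψ , q , refl)) = ∼∨-elimˡ (∼∨-hyp q (proj₂ (⟦⟧-inhabited (template p) _)))

    instantiate-∼ : ∀ {θ} → θ ∈ ⟦ template p ⟧ (body p [ var p ≔ wit (proj₁ witness) ] ∷ fmls p) →
                    Der (hyps instantiate) (∼ θ)
    instantiate-∼ r = ∼∨-elimʳ (∼∨-hyp (proj₂ (⟦⟧-inhabited (modal s) _)) r)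

  process : Stage → Problem → Stage
  process s p with em {Admissible s p}
  ... | yes A = instantiate s p A
  ... | no _  = s

  process-⊇ : ∀ s p {φ} → φ ∈ hyps s → Der (hyps (process s p)) φ
  process-⊇ s p q with em {Admissible s p}
  ... | yes A = instantiate-⊇ s p A q
  ... | no _  = hyp (hyps-Henkin s q) q

  process-∼ : ∀ s p → Admissible s p → ∃ λ a → ∀ {θ} →
              θ ∈ ⟦ template p ⟧ (body p [ var p ≔ wit a ] ∷ fmls p) → Der (hyps (process s p)) (∼ θ)
  process-∼ s p A with em {Admissible s p}
  ... | yes A′ = _ , instantiate-∼ s p A′
  ... | no n   = contradiction A n

  module Limit (start : Stage) where

    stage : ℕ → Stage
    stage zero    = start
    stage (suc n) = process (stage n) (problemAt n)

    -- Derivability replaces a plain union because the stages do not grow as sets: an old `∼ ψ` is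
    -- only derivable from the later `∼ (ψ ∨' θ)`.
    limit : Pred Fml 0ℓ
    limit φ = ∃ λ n → Der (hyps (stage n)) φ

    stage-mono : ∀ k {n φ} → Der (hyps (stage n)) φ → Der (hyps (stage (k + n))) φ
    stage-mono zero    d = d
    stage-mono (suc k) d = bind (λ _ → process-⊇ (stage (k + _)) (problemAt (k + _))) (stage-mono k d)

    limit-closed : ∀ {φ} → Der limit φ → φ ∈ limit
    limit-closed (hyp _ p) = p
    limit-closed (thm d) = 0 , thm d
    limit-closed (app {φ = θ} d e) =
      let m , d′ = limit-closed d
          n , e′ = limit-closed e
      in n + m , app (stage-mono n d′)
           (subst (λ k → Der (hyps (stage k)) θ) (ℕₚ.+-comm m n) (stage-mono m e′))

    limit-Henkin : ∀ {φ} → φ ∈ limit → IsHenkin φ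
    limit-Henkin (_ , d) = Der-Henkin d

    limit-consistent : ¬ Der limit ⊥'
    limit-consistent d = let n , d′ = limit-closed d in consistent (stage n) d′

    -- One visit to each problem is enough. Consistency with the limit implies consistency with the
    -- stage at which the problem comes up, since `∼ ψ` from that stage and `∼ θ` from the problem
    -- give `∼ (ψ ∨' θ)`; the problem is therefore admissible there.
    limit-instantiates : ∀ {n} {F : Modal (suc n)} {φs x χ} → DisjunctiveTemplate F →
      VecAll.All IsHenkin φs → IsHenkin (∀' x χ) →
      ¬ Der (limit ∪ ⟦ neg F ⟧ (∀' x χ ∷ φs)) ⊥' →
      ∃ λ a → ∀ {θ} → θ ∈ ⟦ F ⟧ (χ [ x ≔ wit a ] ∷ φs) → ∼ θ ∈ limit
    limit-instantiates {F = F} {φs} {x} {χ} D hs h con =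
      let k , e = problemAt-onto (DisjunctiveTemplate.disjunctive D) φs x χ
          s = stage k
          a , f = process-∼ s (problem F φs x χ) (admissible D hs h (con ∘ bind (from k)))
      in a , λ p → suc k , subst (λ p → Der (hyps (process s p)) _) (sym e) (f p)
      where
      from : ∀ k {φ} → IsHenkin φ → φ ∈ extended (stage k) (problem F φs x χ) (∀' x χ) →
             Der (limit ∪ ⟦ neg F ⟧ (∀' x χ ∷ φs)) φ
      from k h′ (inj₁ q) = hyp h′ (inj₁ (k , hyp h′ (inj₁ q)))
      from k h′ (inj₂ q) with Join.⟦neg-join⟧⁻ (modal (stage k)) F (∀' x χ) φs (values (stage k)) q
      ... | ψ , θ , p , r , refl =
        let hψ = Henkin-∼ (⟦⟧-Henkin (modal (stage k)) (areHenkin (stage k)) p)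
            hθ = Henkin-∼ (⟦⟧-Henkin F (h ∷ hs) r)
        in ∼∨-intro (hyp hψ (inj₁ (k , hyp hψ (inj₂ (ψ , p , refl))))) (hyp hθ (inj₂ (θ , r , refl)))

    -- A single formula ∼ φ is handled as the template 𝐩 in which 𝐪 does not occur.
    limit-maximal : ∀ {φ} → IsHenkin φ → Consistent CS (limit ∪ ｛ φ ｝) → φ ∈ limit
    limit-maximal {φ} h con =
      let _ , f = limit-instantiates {F = letter (suc zero)} {∼ φ ∷ []} {0} {⊥'}
                    record { disjunctive = letter _ ; atMostOnce = [] ∷ [] }
                    (Henkin-∼ h ∷ []) (Henkin-∀ 0 Henkin-⊥)
                    (Consistent⇒¬Der con ∘ bind λ
                      { k (inj₁ p) → hyp k (inj₁ p)
                      ; k (inj₂ (_ , refl , refl)) → DN-intro (assumption h) })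
          n , d = f refl
      in n , DN-elim d

    limit-world : 𝓦 CS
    limit-world = record
      { set = limit
      ; mcs = record
        { henkin     = λ p → IsHenkin.henkin (limit-Henkin p)
        ; consistent = ¬Der⇒Consistent limit-Henkin limit-consistent
        ; maximal    = λ h → limit-maximal (hk h)
        }
      ; admit = λ F D φs hs x χ h con →
          let hs′ = VecAll.map hk hs
              a , f = limit-instantiates D hs′ (hk h) (Consistent⇒¬Der con)
          in a , ¬Der⇒Consistent
               [ limit-Henkin , ⟦⟧-Henkin (neg F) (Henkin-sub _ χ (Henkin-∀⁻ (hk h)) ∷ hs′) ]′
               -- The negated instances already belong to the limit, so adding them changes nothing.
               (limit-consistent ∘ bind λ { k (inj₁ p) → hyp k p ; k (inj₂ (_ , p , refl)) → hyp k (f p) })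
      }

    Γ𝓡limit : 𝓡 Γ limit-world
    Γ𝓡limit p = 0 , hyp (♯-Henkin p) (inj₁ p)

  counterworld : ∀ {φ} → IsHenkin φ → ¬ (∃ λ t → (t ∶[ wits φ ] φ) ∈ set Γ) →
                 ∃ λ Δ → 𝓡 Γ Δ × (∼ φ) ∈ set Δ
  counterworld {φ} h unjustified = limit-world , (λ {_} → Γ𝓡limit) , 0 , hyp (Henkin-∼ h) (inj₂ (φ , refl , refl))
    where
    start : Stage
    start = record
      -- The one-letter template with value `φ`, whose negated instantiation set is just `∼ φ`.
      { modal      = letter {1} zero
      ; isTemplate = record { disjunctive = letter zero ; atMostOnce = [] ∷ [] }
      ; values     = φ ∷ []
      ; areHenkin  = h ∷ []
      ; consistent = λ d → case inconsistent⇒Der (letter zero) (h ∷ []) d of λ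
          { (_ , refl , d′) → unjustified (♯-lift d′) }
      }
    open Limit start

-- Truth in the canonical model

all-wit : ∀ {n} (vs : Vec Var n) → (∀ x → ¬ (basic x ∈ₗ toList vs)) → ∃ λ as → vs ≡ Vec.map wit as
all-wit [] _ = [] , refl
all-wit (basic x ∷ vs) closed = contradiction (here refl) (closed x)
all-wit (wit a ∷ vs) closed =
  let as , e = all-wit vs (λ x → closed x ∘ there) in a ∷ as , cong (wit a ∷_) e

Closed-≔ : ∀ {x} φ a → Closed (∀' x φ) → Closed (φ [ x ≔ wit a ])
Closed-≔ {x} φ a closed y p with fv-sub⁻ (single x (wit a)) φ p
... | w , q , e with w ≟ basic x
... | no n = closed y (subst (_∈ₛ fv (∀' x φ)) (sym e) (∈-delete⁺ (fv φ) q n))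

Closed-ground : ∀ v φ → Closed (sub (ground v) φ)
Closed-ground v φ x p with fv-sub⁻ (ground v) φ p
... | basic _ , _ , ()
... | wit _ , _ , ()

wits⊆subscript : ∀ {t X φ} → IsHenkin (t ∶[ X ] φ) → ∀ {v} → v ∈ₛ wits φ → v ∈ₛ X
wits⊆subscript {φ = φ} h p with ∈-wits⁻ φ p
... | q , a , refl = Henkin-subscript h q

closed-subscript∩fv⊆wits : ∀ X φ → (∀ x → ¬ (basic x ∈ₛ X)) → ∀ {v} → v ∈ₛ X → v ∈ₛ fv φ → v ∈ₛ wits φ
closed-subscript∩fv⊆wits X φ closed {basic x} p _ = contradiction p (closed x)
closed-subscript∩fv⊆wits X φ closed {wit a}   _ q = ∈-wits⁺ φ q

module CanonicalModel (em : ExcludedMiddle 0ℓ) (CS : ConstSpec) (appropriate : AxiomaticallyAppropriate CS) where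

  open Derivability CS
  open Lifting em CS appropriate
  open World

  -- The ordinary Henkin property is admitting instantiation for the template that consists of 𝐪
  -- alone.
  ∀∉⇒∼∈ : ∀ (Γ : 𝓦 CS) {x φ} → IsHenkin (∀' x φ) → ¬ (∀' x φ ∈ set Γ) → ∃ λ a → (∼ (φ [ x ≔ wit a ])) ∈ set Γ
  ∀∉⇒∼∈ Γ {x} {φ} h n =
    let ∼∀ = ∉⇒∼∈ Γ h n
        a , con = admit Γ (letter zero) record { disjunctive = letter zero ; atMostOnce = [] ∷ [] }
                    [] [] x φ (IsHenkin.henkin h)
                    (¬Der⇒Consistent [ Γ-Henkin Γ , ⟦⟧-Henkin (neg (letter zero)) (h ∷ []) ]′
                      (¬Der-⊥ Γ ∘ bind λ { k (inj₁ p) → hyp k p ; k (inj₂ (_ , refl , refl)) → hyp k ∼∀ }))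
        h′ = Henkin-sub (single x (wit a)) φ (Henkin-∀⁻ h)
    in a , ∉⇒∼∈ Γ h′ λ p → Consistent⇒¬Der con
         (app (hyp (Henkin-∼ h′) (inj₂ (_ , refl , refl))) (mono inj₁ (∈⇒Der Γ p)))

  mutual

    Forces⇒∈ : ∀ k (Γ : 𝓦 CS) φ → depth φ ≤ k → IsHenkin φ → Closed φ → Forces k Γ φ → φ ∈ set Γ
    Forces⇒∈ k Γ (atom P vs) _ _ _ (lift (as , refl , p)) = p
    Forces⇒∈ k Γ ⊥' _ _ _ (lift ())
    Forces⇒∈ (suc k) Γ (φ ⇒ ψ) (s≤s le) h closed f with em {φ ∈ set Γ}
    ... | yes p = Der⇒∈ Γ (const-Der (Henkin-⇒ˡ h) (∈⇒Der Γ
      (Forces⇒∈ k Γ ψ (ℕₚ.m⊔n≤o⇒n≤o (depth φ) _ le) (Henkin-⇒ʳ h) (λ x → closed x ∘ ∈-∪⁺ʳ (fv φ) (fv ψ))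
        (f (∈⇒Forces k Γ φ (ℕₚ.m⊔n≤o⇒m≤o _ (depth ψ) le) (λ x → closed x ∘ ∈-∪⁺ˡ (fv φ) (fv ψ)) p)))))
    ... | no n = Der⇒∈ Γ (deduction (Henkin-⇒ˡ h) (ex-falso (Henkin-⇒ʳ h)
      (app (weaken (∈⇒Der Γ (∉⇒∼∈ Γ (Henkin-⇒ˡ h) n))) (assumption (Henkin-⇒ˡ h)))))
    Forces⇒∈ (suc k) Γ (∀' x φ) (s≤s le) h closed f with em {∀' x φ ∈ set Γ}
    ... | yes p = p
    ... | no n =
      let a , ∼φa = ∀∉⇒∼∈ Γ h n
          φa = Forces⇒∈ k Γ (φ [ x ≔ wit a ]) (subst (_≤ k) (sym (depth-sub _ φ)) le)
                 (Henkin-sub _ φ (Henkin-∀⁻ h)) (Closed-≔ φ a closed) (f a)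
      in contradiction (app (∈⇒Der Γ ∼φa) (∈⇒Der Γ φa)) (¬Der-⊥ Γ)
    -- The evidence condition alone gives membership; A3 enlarges its subscript from `wits φ` to
    -- `X`.
    Forces⇒∈ (suc k) Γ (t ∶[ X ] φ) _ h _ (p , _) =
      Der⇒∈ Γ (extend X (wits⊆subscript h) (∈⇒Der Γ p))

    ∈⇒Forces : ∀ k (Γ : 𝓦 CS) φ → depth φ ≤ k → Closed φ → φ ∈ set Γ → Forces k Γ φ
    ∈⇒Forces k Γ (atom P vs) _ closed p with all-wit vs (λ x → closed x ∘ ∈-fromList⁺)
    ... | as , refl = lift (as , refl , p)
    ∈⇒Forces k Γ ⊥' _ _ p = contradiction (∈⇒Der Γ p) (¬Der-⊥ Γ)
    ∈⇒Forces (suc k) Γ (φ ⇒ ψ) (s≤s le) closed p f =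
      ∈⇒Forces k Γ ψ (ℕₚ.m⊔n≤o⇒n≤o (depth φ) _ le) (λ x → closed x ∘ ∈-∪⁺ʳ (fv φ) (fv ψ))
        (Der⇒∈ Γ (app (∈⇒Der Γ p) (∈⇒Der Γ (Forces⇒∈ k Γ φ (ℕₚ.m⊔n≤o⇒m≤o _ (depth ψ) le)
          (Henkin-⇒ˡ (Γ-Henkin Γ p)) (λ x → closed x ∘ ∈-∪⁺ˡ (fv φ) (fv ψ)) f))))
    ∈⇒Forces (suc k) Γ (∀' x φ) (s≤s le) closed p a =
      ∈⇒Forces k Γ (φ [ x ≔ wit a ]) (subst (_≤ k) (sym (depth-sub _ φ)) le) (Closed-≔ φ a closed)
        (Der⇒∈ Γ (∀-elim (FreeFor-wit a x φ (Henkin-∀⁻ (Γ-Henkin Γ p))) (∈⇒Der Γ p)))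
    ∈⇒Forces (suc k) Γ (t ∶[ X ] φ) (s≤s le) closed p =
      q , λ Δ Γ𝓡Δ v → ∈⇒Forces k Δ (sub (ground v) φ) (subst (_≤ k) (sym (depth-sub _ φ)) le)
        (Closed-ground v φ)
        -- Accessibility hands over the universal closure of `φ`, which yields every ground
        -- instance.
        (Der⇒∈ Δ (∀*-ground v (freeBasics φ) φ (∈-freeBasics φ) (∈⇒Der Δ (Γ𝓡Δ (t , φ , q , refl)))))
      where
      q : (t ∶[ wits φ ] φ) ∈ set Γ
      -- Closedness leaves only witnesses in `X`, and A2 removes those not free in `φ`.
      q = Der⇒∈ Γ (shrink (wits φ) X (wits⊆subscript (Γ-Henkin Γ p)) (closed-subscript∩fv⊆wits X φ closed) (∈⇒Der Γ p))

  fullyExplanatory : ∀ (Γ : 𝓦 CS) φ → IsHenkin φ → Closed φ →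
                     (∀ (Δ : 𝓦 CS) → 𝓡 Γ Δ → Δ ⊩ φ) → ∃ λ t → Γ ⊩ t ∶[ wits φ ] φ
  fullyExplanatory Γ φ h closed valid with em {∃ λ t → (t ∶[ wits φ ] φ) ∈ set Γ}
  ... | yes (t , p) = t , p , λ Δ Γ𝓡Δ v →
    -- Grounding does not change a closed formula, so the assumption on `φ` is the required truth
    -- condition.
    subst (Forces (depth φ) Δ) (sym (sub-id φ (fixed v))) (valid Δ Γ𝓡Δ)
    where
    fixed : ∀ v {w} → w ∈ₛ fv φ → ground v w ≡ w
    fixed v {basic x} q = contradiction q (closed x)
    fixed v {wit a}   _ = refl
  ... | no unjustified with Extension.counterworld em CS appropriate Γ h unjustified
  ... | Δ , Γ𝓡Δ , ∼φ∈Δ =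
    let φ∈Δ = Forces⇒∈ (depth φ) Δ φ ℕₚ.≤-refl h closed (valid Δ Γ𝓡Δ)
    in contradiction (app (∈⇒Der Δ ∼φ∈Δ) (∈⇒Der Δ φ∈Δ)) (¬Der-⊥ Δ)

mainTheorem4 : ExcludedMiddle (Level.suc 0ℓ) →
    (CS : ConstSpec) → VariantClosed CS → AxiomaticallyAppropriate CS →
    (Γ : 𝓦 CS) (φ : Fml) → Henkin φ → Closed φ →
    (∀ (Δ : 𝓦 CS) → 𝓡 Γ Δ → Δ ⊩ φ) →
    ∃ λ t → Γ ⊩ t ∶[ wits φ ] φ
mainTheorem4 em CS _ appropriate Γ φ h =
  CanonicalModel.fullyExplanatory (map′ lower lift em) CS appropriate Γ φ (hk h)
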